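{- Let $s\geq 3$ and $d\geq 5$ be fixed integers with $d\geq s+2$. Then there is a constant $c=c(d)$ such that there exists a $K_s$-free graph on $n$ vertices with VC-dimension at most $d$ and no independent set of size $c\,n^{\frac{2}{s+1}}\log n$.
   Context: For a graph $G=(V,E)$ and $v\in V$, $N(v)$ denotes the set of vertices adjacent to $v$ ($v\notin N(v)$). The VC-dimension of a set system $\mathcal{F}$ on ground set $V$ is the largest $d$ such that some $d$-element $S\subset V$ satisfies: for every $B\subset S$ there is $A\in\mathcal{F}$ with $A\cap S=B$. The VC-dimension of a graph $G$ is the VC-dimension of $\{N(v):v\in V\}$. Logarithms are natural. -}

module Defs where

open import Data.Nat using (ℕ)
open import Data.Bool using (Bool; true; false)
open import Data.Fin using (Fin)
open import Data.Fin.Subset using (Subset; _∈_; _∩_; _⊆_; ∣_∣)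
open import Data.Vec using (tabulate)
open import Data.Product using (Σ; ∃)
open import Data.Empty using (⊥)
open import Relation.Binary.PropositionalEquality using (_≡_; _≢_)
open import Function.Definitions using (Injective)

record Graph (n : ℕ) : Set where
  field
    adj    : Fin n → Fin n → Bool
    sym    : ∀ u v → adj u v ≡ adj v u
    irrefl : ∀ v → adj v v ≡ false
open Graph public

N : ∀ {n} → Graph n → Fin n → Subset n
N G v = tabulate (adj G v)

KFree : ∀ {n} → ℕ → Graph n → Set
KFree {n} s G = (f : Fin s → Fin n) → Injective _≡_ _≡_ f →
  (∀ i j → i ≢ j → adj G (f i) (f j) ≡ true) → ⊥

Shattered : ∀ {n} → Graph n → Subset n → Set
Shattered G S = ∀ B → B ⊆ S → ∃ λ v → (N G v ∩ S) ≡ B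

VCdim≤ : ∀ {n} → Graph n → ℕ → Set
VCdim≤ G d = ∀ S → Shattered G S → ∣ S ∣ Data.Nat.≤ d

Independent : ∀ {n} → Graph n → Subset n → Set
Independent G I = ∀ u v → u ∈ I → v ∈ I → adj G u v ≡ false

{-# OPTIONS --safe #-}
module Submission where

-- Alteration of a random graph with edge probability p = 2 / (2 + a), where a is a
-- constant times n ^ (2 / (s + 1)).  Two patterns are forbidden: the clique K_s and
-- the crown, i.e. K_{s+2,s+2} minus a perfect matching.  Every shattered set of s + 3
-- vertices yields a crown: fix one of its vertices y; for each other vertex x the sets
-- S − x and S − x − y have different witnesses, one of which is not x.  A pattern with
-- v vertices and e edges satisfies (s + 1)(v − 2) ≤ 2(e − 1), so the expected number of
-- copies through a given edge, conditioned on that edge, is a small constant.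
--
-- Delete from the random graph all edges of a maximal family of edge-disjoint forbidden
-- copies.  If a set T of t vertices becomes independent, then every pair in T is a
-- non-edge or lies in a copy of the family.  Summing over the families that meet T,
-- this has probability at most ((1 + a) / (2 + a)) ^ (t choose 2), which is below n ^ (− t)
-- once t exceeds a constant times a log n, and a union bound over T concludes.

open import Defs hiding (sym)
open import Data.Bool using (Bool; true; false; not; if_then_else_)
import Data.Bool as Bool
open import Data.Bool.Properties using (¬-not)
open import Data.Fin using (Fin; zero; suc; toℕ; combine; remQuot; punchIn; splitAt; _↑ˡ_; _↑ʳ_)
import Data.Fin as Fin
import Data.Fin.Properties as Finₚ
open import Data.Fin.Subset using (Subset; ∣_∣; _∩_; ∁; ⁅_⁆; inside; outside)
  renaming (_∈_ to _∈ˢ_; _∉_ to _∉ˢ_)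
open import Data.Fin.Subset.Properties
  using (x∈p∩q⁺; x∈p∩q⁻; p∩q⊆p; x∈∁p⇒x∉p; x∉p⇒x∈∁p; x∈⁅x⁆; x∈⁅y⁆⇒x≡y; ⊆-trans)
open import Data.List
  using (List; []; _∷_; _++_; map; concatMap; length; allFin; cartesianProductWith; filter)
open import Data.List.Membership.Propositional using (_∈_; _∉_; find; lose)
open import Data.List.Membership.Propositional.Properties
  using (∈-++⁺ˡ; ∈-++⁺ʳ; ∈-++⁻; ∈-map⁺; ∈-map⁻; ∈-filter⁺; ∈-filter⁻; ∈-concatMap⁺; ∈-allFin;
         ∈-cartesianProductWith⁺; ∈-cartesianProductWith⁻)
open import Data.List.Properties using (map-++; length-++; length-map; length-filter; length-tabulate)
open import Data.List.Relation.Unary.All as All using (All; []; _∷_; all?)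
import Data.List.Relation.Unary.All.Properties as Allₚ
open import Data.List.Relation.Unary.AllPairs using ([]; _∷_)
open import Data.List.Relation.Unary.Any using (here; there; any?)
open import Data.List.Relation.Unary.Unique.Propositional using (Unique)
import Data.List.Relation.Unary.Unique.DecPropositional as DecUnique
import Data.List.Relation.Unary.Unique.Propositional.Properties as Uniqueₚ
open import Data.Maybe using (Maybe; just; nothing; maybe)
open import Data.Nat using (ℕ; zero; suc; pred; _+_; _*_; _^_; _∸_; _≤_; _<_; z≤n; s≤s; _≤?_; _<?_;
                            NonZero; >-nonZero; >-nonZero⁻¹)
open import Data.Nat.ListAction using (sum)
open import Data.Nat.ListAction.Properties using (sum-++)
open import Data.Nat.Logarithm using (⌊log₂_⌋; ⌊log₂⌋-mono-≤; ⌊log₂[2^n]⌋≡n)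
open import Data.Nat.Properties hiding (_≤?_; _<?_)
open import Data.Nat.Tactic.RingSolver using (solve-∀)
open import Data.Product using (∃; _×_; _,_; proj₁; proj₂; uncurry)
open import Data.Product.Properties using (,-injective)
open import Data.Sum using (_⊎_; inj₁; inj₂; [_,_])
open import Data.Vec as Vec using (Vec; []; _∷_; lookup)
open import Data.Vec.Functional using (Vector; tail; updateAt)
open import Data.Vec.Functional.Properties using (updateAt-updates; updateAt-minimal)
open import Data.Vec.Properties using (lookup∘tabulate; []=⇒lookup; lookup⇒[]=)
open import Function using (_∘_; const)
open import Function.Definitions using (Injective)
open import Relation.Binary.PropositionalEquality hiding ([_])
open import Relation.Nullary using (¬_; Dec; yes; no; contradiction)

-- Avoiding cylinders

∏ : ∀ {m} → (Fin m → ℕ) → ℕ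
∏ {zero}  f = 1
∏ {suc m} f = f zero * ∏ (f ∘ suc)

∏-const : ∀ m k → ∏ {m} (const k) ≡ k ^ m
∏-const zero    k = refl
∏-const (suc m) k = cong (k *_) (∏-const m k)

set : ∀ {A : Set} {m} → Vector A m → Fin m → A → Vector A m
set c i x = updateAt c i (const x)

set-same : ∀ {A : Set} {m} (c : Vector A m) i x → set c i x i ≡ x
set-same c i x = updateAt-updates i c

set-other : ∀ {A : Set} {m} (c : Vector A m) {i j} x → j ≢ i → set c i x j ≡ c j
set-other c x j≢i = updateAt-minimal _ _ c j≢i

∏-set : ∀ {A : Set} {m} (w : A → ℕ) (c : Vector A m) i x →
        ∏ (w ∘ set c i x) * w (c i) ≡ w x * ∏ (w ∘ c)
∏-set w c zero    x = shuffle (w x) (∏ (w ∘ tail c)) (w (c zero))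
  where
  shuffle : ∀ p q r → (p * q) * r ≡ p * (r * q)
  shuffle = solve-∀
∏-set w c (suc i) x = begin
  (w (c zero) * ∏ (w ∘ set (tail c) i x)) * w (c (suc i))
    ≡⟨ *-assoc (w (c zero)) _ _ ⟩
  w (c zero) * (∏ (w ∘ set (tail c) i x) * w (c (suc i)))
    ≡⟨ cong (w (c zero) *_) (∏-set w (tail c) i x) ⟩
  w (c zero) * (w x * ∏ (w ∘ tail c))
    ≡⟨ shuffle (w (c zero)) (w x) _ ⟩
  w x * (w (c zero) * ∏ (w ∘ tail c)) ∎
  where
  open ≡-Reasoning
  shuffle : ∀ p q r → p * (q * r) ≡ q * (p * r)
  shuffle = solve-∀

-- States of a partially revealed random set of coordinates, in which a coordinate
-- is on with probability 2 / (2 + a).  A pending coordinate is one that must end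
-- up off or inside a claimed set; its weight is slightly more than that of off,
-- and the excess pays for all the sets that may claim it.
data Cell : Set where
  on off pending free : Cell

matches : Cell → Bool → Bool
matches on      b = b
matches off     b = not b
matches pending _ = false
matches free    _ = true

isOpen : Cell → Bool
isOpen on      = false
isOpen off     = false
isOpen pending = true
isOpen free    = true

isPending : Cell → Bool
isPending pending = true
isPending _       = false

State : ℕ → Set
State m = Fin m → Cell

_Matches_ : ∀ {m} → State m → (Fin m → Bool) → Set
c Matches ω = ∀ i → matches (c i) (ω i) ≡ true

module Weighted (a : ℕ) where

  cellWeight : Cell → ℕ
  cellWeight on      = 2
  cellWeight off     = a
  cellWeight pending = 1 + a
  cellWeight free    = 2 + a

  weight : ∀ {m} → State m → ℕ
  weight c = ∏ (cellWeight ∘ c)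

  totalWeight : ∀ {m} → List (State m) → ℕ
  totalWeight = sum ∘ map weight

  totalWeight-++ : ∀ {m} (cs ds : List (State m)) →
                   totalWeight (cs ++ ds) ≡ totalWeight cs + totalWeight ds
  totalWeight-++ cs ds = trans (cong sum (map-++ weight cs ds)) (sum-++ (map weight cs) _)

  restrict : ∀ {m} → Bool → List (State (suc m)) → List (State m)
  restrict b []       = []
  restrict b (c ∷ cs) =
    if matches (c zero) b then tail c ∷ restrict b cs else restrict b cs

  restrict-∈ : ∀ {m} b {c : State (suc m)} {cs} → c ∈ cs → matches (c zero) b ≡ true →
               tail c ∈ restrict b cs
  restrict-∈ b {c} (here refl) eq rewrite eq = here refl
  restrict-∈ b {cs = d ∷ _} (there c∈cs) eq with matches (d zero) b
  ... | true  = there (restrict-∈ b c∈cs eq)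
  ... | false = restrict-∈ b c∈cs eq

  -- An on state survives only in the first sum, an off state only in the second, a free one in
  -- both, so the weights `2`, `a` and `2 + a` balance exactly. Only a pending state loses: it
  -- matches neither value and is dropped.
  restrict-weight : ∀ {m} (cs : List (State (suc m))) →
    2 * totalWeight (restrict true cs) + a * totalWeight (restrict false cs) ≤ totalWeight cs
  restrict-weight [] = ≤-reflexive (cong (0 +_) (*-zeroʳ a))
  restrict-weight (c ∷ cs) with c zero | restrict-weight cs
  ... | on | ih = ≤-trans (≤-reflexive (lemma (weight (tail c)) _ (a * _))) (+-monoʳ-≤ _ ih)
    where
    lemma : ∀ w x y → 2 * (w + x) + y ≡ 2 * w + (2 * x + y)
    lemma = solve-∀
  ... | off | ih = ≤-trans (≤-reflexive
    (lemma a (weight (tail c)) (totalWeight (restrict true cs)) _)) (+-monoʳ-≤ _ ih)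
    where
    lemma : ∀ k w x y → 2 * x + k * (w + y) ≡ k * w + (2 * x + k * y)
    lemma = solve-∀
  ... | pending | ih = ≤-trans ih (m≤n+m _ _)
  ... | free | ih = ≤-trans (≤-reflexive (lemma a (weight (tail c)) _ _)) (+-monoʳ-≤ _ ih)
    where
    lemma : ∀ k w x y → 2 * (w + x) + k * (w + y) ≡ (2 + k) * w + (2 * x + k * y)
    lemma = solve-∀

  -- Method of conditional expectations: `totalWeight cs` over `(2 + a) ^ m` is at least the
  -- expected number of states matched by the random set. If this ratio is below one,
  -- `restrict-weight` keeps it below one for some value of the first coordinate.
  avoid : ∀ {m} (cs : List (State m)) → totalWeight cs < (2 + a) ^ m →
          ∃ λ ω → ∀ {c} → c ∈ cs → ¬ c Matches ω
  avoid {zero}  []       _   = (λ ()) , λ ()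
  avoid {zero}  (c ∷ cs) (s≤s ())
  avoid {suc m} cs       bound = choose (totalWeight (restrict true cs) <? (2 + a) ^ m)
                                        (totalWeight (restrict false cs) <? (2 + a) ^ m)
    where
    extend : ∀ b → (∃ λ ω → ∀ {c} → c ∈ restrict b cs → ¬ c Matches ω) →
             ∃ λ ω → ∀ {c} → c ∈ cs → ¬ c Matches ω
    extend b (ω , avoids) = (λ { zero → b ; (suc i) → ω i }) ,
      λ c∈cs match → avoids (restrict-∈ b c∈cs (match zero)) (match ∘ suc)

    choose : _ → _ → _
    choose (yes small) _           = extend true (avoid (restrict true cs) small)
    choose (no _)      (yes small) = extend false (avoid (restrict false cs) small)
    choose (no big₁)   (no big₀)   = contradiction bound (≤⇒≯ (begin
      (2 + a) * (2 + a) ^ m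
        ≡⟨ *-distribʳ-+ ((2 + a) ^ m) 2 a ⟩
      2 * (2 + a) ^ m + a * (2 + a) ^ m
        ≤⟨ +-mono-≤ (*-monoʳ-≤ 2 (≮⇒≥ big₁)) (*-monoʳ-≤ a (≮⇒≥ big₀)) ⟩
      2 * totalWeight (restrict true cs) + a * totalWeight (restrict false cs)
        ≤⟨ restrict-weight cs ⟩
      totalWeight cs ∎))
      where open ≤-Reasoning

  -- Claimed sets and branching over them

  claim : ∀ {m} → State m → List (Fin m) → Maybe (State m)
  claim c []      = just c
  claim c (i ∷ H) = if isOpen (c i) then claim (set c i on) H else nothing

  claimWeight : ∀ {m} → State m → List (Fin m) → ℕ
  claimWeight c H = maybe weight 0 (claim c H)

  open-weight : ∀ x → isOpen x ≡ true → a ≤ cellWeight x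
  open-weight pending _ = n≤1+n a
  open-weight free    _ = m≤n+m a 2

  -- A claimed coordinate was pending or free, hence of weight at least `a`, and has weight 2
  -- afterwards; a blocked claim counts 0.
  claimWeight-≤ : ∀ {m} (c : State m) H →
                  a ^ length H * claimWeight c H ≤ 2 ^ length H * weight c
  claimWeight-≤ c []      = ≤-refl
  claimWeight-≤ c (i ∷ H) with isOpen (c i) in eq
  ... | false = ≤-trans (≤-reflexive (*-zeroʳ (a * a ^ length H))) z≤n
  ... | true  = begin
    a * a ^ length H * claimWeight c′ H   ≡⟨ *-assoc a _ _ ⟩
    a * (a ^ length H * claimWeight c′ H) ≤⟨ *-monoʳ-≤ a (claimWeight-≤ c′ H) ⟩
    a * (2 ^ length H * weight c′)        ≡⟨ shuffle a (2 ^ length H) (weight c′) ⟩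
    2 ^ length H * (weight c′ * a)        ≤⟨ *-monoʳ-≤ (2 ^ length H)
                                               (*-monoʳ-≤ (weight c′) (open-weight (c i) eq)) ⟩
    2 ^ length H * (weight c′ * cellWeight (c i))
                                          ≡⟨ cong (2 ^ length H *_) (∏-set cellWeight c i on) ⟩
    2 ^ length H * (2 * weight c)         ≡⟨ regroup (2 ^ length H) (weight c) ⟩
    2 * 2 ^ length H * weight c           ∎
    where
    open ≤-Reasoning
    c′ = set c i on
    shuffle : ∀ p q r → p * (q * r) ≡ q * (r * p)
    shuffle = solve-∀
    regroup : ∀ p q → p * (2 * q) ≡ 2 * p * q
    regroup = solve-∀

  -- `Unique` matters because an entry met a second time would already be on and block the claim.
  claim-open : ∀ {m} (c : State m) H → Unique H → (∀ {i} → i ∈ H → isOpen (c i) ≡ true) →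
    ∃ λ c′ → claim c H ≡ just c′ × (∀ {i} → i ∈ H → c′ i ≡ on) × (∀ {i} → i ∉ H → c′ i ≡ c i)
  claim-open c [] _ _ = c , refl , (λ ()) , λ _ → refl
  claim-open c (i ∷ H) (i∉H ∷ unique) isopen
    with claim-open (set c i on) H unique
           (λ j∈H → trans (cong isOpen (set-other c on λ { refl → All.lookup i∉H j∈H refl }))
                          (isopen (there j∈H)))
  ... | c′ , claimed , claimed-on , unclaimed rewrite isopen (here refl) =
    c′ , claimed , claimed-on′ , unclaimed′
    where
    claimed-on′ : ∀ {j} → j ∈ i ∷ H → c′ j ≡ on
    claimed-on′ (here refl)  = trans (unclaimed (λ i∈H → All.lookup i∉H i∈H refl)) (set-same c i on)
    claimed-on′ (there j∈H) = claimed-on j∈H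
    unclaimed′ : ∀ {j} → j ∉ i ∷ H → c′ j ≡ c j
    unclaimed′ j∉ = trans (unclaimed (j∉ ∘ there)) (set-other c on (j∉ ∘ here))

  -- X is the excess of a pending coordinate over an off one, and the hypothesis on W
  -- holds since claiming H multiplies the weight by at most 2 / a per coordinate.
  Sparse : ∀ {A : Set} → List (List A) → Set
  Sparse {A} L = ∀ X (W : List A → ℕ) →
    (∀ {H} → H ∈ L → a ^ length H * W H ≤ 2 ^ length H * ((1 + a) * X)) → sum (map W L) ≤ X

  module Branching {m : ℕ} (𝓗 : Fin m → List (List (Fin m))) where

    -- A decision tree that explains each pending coordinate of P: it is off, or some set in `𝓗 f`
    -- claims it. A coordinate swept up by an earlier claim is skipped, so a set that covers several
    -- coordinates of P is paid for once.
    branch : State m → List (Fin m) → List (State m)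
    branch c []      = c ∷ []
    branch c (f ∷ P) = if isPending (c f)
      then branch (set c f off) P ++ concatMap (λ H → maybe (λ c′ → branch c′ P) [] (claim c H)) (𝓗 f)
      else branch c P

    -- Of the `1 + a` parts of a pending cell, the off branch takes `a` and all claims together must
    -- fit into the remaining one, which is what `Sparse` provides.
    branch-weight : (∀ f → Sparse (𝓗 f)) → ∀ c P → totalWeight (branch c P) ≤ weight c
    branch-weight sparse c [] = ≤-reflexive (+-identityʳ _)
    branch-weight sparse c (f ∷ P) with c f in eq
    ... | on   = branch-weight sparse c P
    ... | off  = branch-weight sparse c P
    ... | free = branch-weight sparse c P
    ... | pending = begin
      totalWeight (branch c₀ P ++ concatMap claims (𝓗 f))
        ≡⟨ totalWeight-++ (branch c₀ P) _ ⟩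
      totalWeight (branch c₀ P) + totalWeight (concatMap claims (𝓗 f))
        ≤⟨ +-mono-≤ (branch-weight sparse c₀ P) (claims-weight (𝓗 f)) ⟩
      weight c₀ + sum (map (claimWeight c) (𝓗 f))
        ≤⟨ +-monoʳ-≤ (weight c₀) (sparse f X (claimWeight c) λ {H} _ →
             subst (λ z → a ^ length H * claimWeight c H ≤ 2 ^ length H * z) c≡ (claimWeight-≤ c H)) ⟩
      weight c₀ + X ≡⟨ m+[n∸m]≡n c₀≤c ⟩
      weight c ∎
      where
      open ≤-Reasoning
      c₀ = set c f off
      X  = weight c ∸ weight c₀
      claims : List (Fin m) → List (State m)
      claims H = maybe (λ c′ → branch c′ P) [] (claim c H)

      claims-weight : ∀ L → totalWeight (concatMap claims L) ≤ sum (map (claimWeight c) L)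
      claims-weight []      = ≤-refl
      claims-weight (H ∷ L) = ≤-trans (≤-reflexive (totalWeight-++ (claims H) _))
                                      (+-mono-≤ claims-≤ (claims-weight L))
        where
        claims-≤ : totalWeight (claims H) ≤ claimWeight c H
        claims-≤ with claim c H
        ... | nothing = ≤-refl
        ... | just c′ = branch-weight sparse c′ P

      exchange : weight c₀ * (1 + a) ≡ a * weight c
      exchange = trans (cong (λ z → weight c₀ * cellWeight z) (sym eq)) (∏-set cellWeight c f off)

      c₀≤c : weight c₀ ≤ weight c
      c₀≤c = *-cancelʳ-≤ _ _ (1 + a) (begin
        weight c₀ * (1 + a) ≡⟨ exchange ⟩
        a * weight c        ≤⟨ *-monoˡ-≤ (weight c) (n≤1+n a) ⟩
        (1 + a) * weight c  ≡⟨ *-comm (1 + a) (weight c) ⟩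
        weight c * (1 + a)  ∎)

      c₀≡ : weight c₀ ≡ a * X
      c₀≡ = +-cancelʳ-≡ (a * weight c₀) _ _ (begin-equality
        weight c₀ + a * weight c₀ ≡⟨ shuffle a (weight c₀) ⟩
        weight c₀ * (1 + a)       ≡⟨ exchange ⟩
        a * weight c              ≡⟨ cong (a *_) (m∸n+n≡m c₀≤c) ⟨
        a * (X + weight c₀)       ≡⟨ *-distribˡ-+ a X _ ⟩
        a * X + a * weight c₀     ∎)
        where
        shuffle : ∀ p q → q + p * q ≡ q * (1 + p)
        shuffle = solve-∀

      c≡ : weight c ≡ (1 + a) * X
      c≡ = trans (sym (m∸n+n≡m c₀≤c)) (cong (X +_) c₀≡)

    module _ (ω : Fin m → Bool) (F : List (List (Fin m)))
             (F-on : ∀ {H i} → H ∈ F → i ∈ H → ω i ≡ true)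
             (F-unique : ∀ {H} → H ∈ F → Unique H)
             (F-disjoint : ∀ {H H′ i} → H ∈ F → H′ ∈ F → i ∈ H → i ∈ H′ → H ≡ H′)
             (F⊆𝓗 : ∀ {H f} → H ∈ F → f ∈ H → H ∈ 𝓗 f)
      where

      -- Invariant along the path that follows ω. By `on-full`, claims settle whole members of F, so
      -- a member through a pending coordinate has no coordinate that is already on.
      record Consistent (c : State m) (P : List (Fin m)) : Set where
        field
          on⇒     : ∀ {i} → c i ≡ on → ω i ≡ true
          on-full : ∀ {H i j} → H ∈ F → i ∈ H → j ∈ H → c i ≡ on → c j ≡ on
          off⇒    : ∀ {i} → c i ≡ off → ω i ≡ false
          pending⇒ : ∀ {i} → c i ≡ pending → i ∈ P
      open Consistent

      drop-settled : ∀ {c f P} → c f ≢ pending → Consistent c (f ∷ P) → Consistent c P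
      drop-settled {c} {f} {P} settled ok = record
        { on⇒ = on⇒ ok ; on-full = on-full ok ; off⇒ = off⇒ ok ; pending⇒ = pending⇒P }
        where
        pending⇒P : ∀ {i} → c i ≡ pending → i ∈ P
        pending⇒P ci with pending⇒ ok ci
        ... | here refl = contradiction ci settled
        ... | there i∈P = i∈P

      -- At a pending coordinate the path takes the off branch if ω is false there, and otherwise
      -- claims the member of F that covers it. At the end nothing is pending, so the state reached
      -- matches ω.
      branch-complete : ∀ c P → (∀ {f} → f ∈ P → ω f ≡ true → ∃ λ H → H ∈ F × f ∈ H) →
                        Consistent c P → ∃ λ c′ → c′ ∈ branch c P × c′ Matches ω
      branch-complete c [] _ ok = c , here refl , match
        where
        match : c Matches ω
        match i with c i in eq
        ... | on      = on⇒ ok eq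
        ... | off     = cong not (off⇒ ok eq)
        ... | pending with () ← pending⇒ ok eq
        ... | free    = refl
      branch-complete c (f ∷ P) covered ok with c f in eq
      ... | on   = branch-complete c P (covered ∘ there)
        (drop-settled (λ e → contradiction (trans (sym eq) e) λ ()) ok)
      ... | off  = branch-complete c P (covered ∘ there)
        (drop-settled (λ e → contradiction (trans (sym eq) e) λ ()) ok)
      ... | free = branch-complete c P (covered ∘ there)
        (drop-settled (λ e → contradiction (trans (sym eq) e) λ ()) ok)
      ... | pending with ω f in ωf
      ...   | false = let c′ , c′∈ , match = branch-complete (set c f off) P (covered ∘ there) ok′
                      in c′ , ∈-++⁺ˡ c′∈ , match
        where
        back : ∀ {i x} → x ≢ off → set c f off i ≡ x → i ≢ f × c i ≡ x
        back {i} x≢ e with i Fin.≟ f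
        ... | yes refl = contradiction (trans (sym e) (set-same c f off)) x≢
        ... | no i≢f   = i≢f , trans (sym (set-other c off i≢f)) e
        ok′ : Consistent (set c f off) P
        ok′ .on⇒ e = on⇒ ok (proj₂ (back (λ ()) e))
        ok′ .on-full {j = j} H∈F i∈H j∈H e =
          let cj = on-full ok H∈F i∈H j∈H (proj₂ (back (λ ()) e)) in
          trans (set-other c off λ { refl → contradiction (trans (sym cj) eq) λ () }) cj
        ok′ .off⇒ {i} e with i Fin.≟ f
        ... | yes refl = ωf
        ... | no i≢f   = off⇒ ok (trans (sym (set-other c off i≢f)) e)
        ok′ .pending⇒ e with back (λ ()) e
        ... | i≢f , ci with pending⇒ ok ci
        ...   | here i≡f  = contradiction i≡f i≢f
        ...   | there i∈P = i∈P
      ...   | true  with covered (here refl) ωf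
      ...     | H , H∈F , f∈H with claim-open c H (F-unique H∈F) H-open
        where
        -- All of H can be claimed: an on coordinate would force f to be on by `on-full`, and an off
        -- one contradicts that ω is true on H.
        H-open : ∀ {i} → i ∈ H → isOpen (c i) ≡ true
        H-open {i} i∈H with c i in ci
        ... | on      = contradiction (trans (sym eq) (on-full ok H∈F i∈H f∈H ci)) λ ()
        ... | off     = contradiction (trans (sym (F-on H∈F i∈H)) (off⇒ ok ci)) λ ()
        ... | pending = refl
        ... | free    = refl
      ...       | c₁ , claimed , claimed-on , unclaimed =
        let c′ , c′∈ , match = branch-complete c₁ P (covered ∘ there) ok′
        in c′ , ∈-++⁺ʳ (branch (set c f off) P)
                  (∈-concatMap⁺ _ (lose (F⊆𝓗 H∈F f∈H)
                    (subst (λ z → c′ ∈ maybe (λ d → branch d P) [] z) (sym claimed) c′∈)))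
              , match
        where
        back : ∀ {i x} → x ≢ on → c₁ i ≡ x → i ∉ H × c i ≡ x
        back {i} x≢ e with any? (i Fin.≟_) H
        ... | yes i∈H = contradiction (trans (sym e) (claimed-on i∈H)) x≢
        ... | no i∉H  = i∉H , trans (sym (unclaimed i∉H)) e
        ok′ : Consistent c₁ P
        ok′ .on⇒ {i} e with any? (i Fin.≟_) H
        ... | yes i∈H = F-on H∈F i∈H
        ... | no i∉H  = on⇒ ok (trans (sym (unclaimed i∉H)) e)
        ok′ .on-full {H′} {i} {j} H′∈F i∈H′ j∈H′ e with any? (j Fin.≟_) H
        ... | yes j∈H = claimed-on j∈H
        ... | no j∉H with any? (i Fin.≟_) H
        -- Disjointness: a member of F that shares i with H is H itself.
        ...   | yes i∈H with refl ← F-disjoint H∈F H′∈F i∈H i∈H′ = contradiction j∈H′ j∉H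
        ...   | no i∉H  = trans (unclaimed j∉H)
                            (on-full ok H′∈F i∈H′ j∈H′ (trans (sym (unclaimed i∉H)) e))
        ok′ .off⇒ e = off⇒ ok (proj₂ (back (λ ()) e))
        ok′ .pending⇒ e with back (λ ()) e
        ... | i∉H , ci with pending⇒ ok ci
        ...   | here refl = contradiction f∈H i∉H
        ...   | there i∈P = i∈P

-- Maximal disjoint families

AllOn : ∀ {m} → (Fin m → Bool) → List (Fin m) → Set
AllOn ω = All (λ i → ω i ≡ true)

allOn? : ∀ {m} (ω : Fin m → Bool) H → Dec (AllOn ω H)
allOn? ω = all? (λ i → ω i Bool.≟ true)

-- F is a maximal family of pairwise disjoint members of Hs inside ω, and ω′ is
-- what remains of ω when their union is deleted.
record Packing {m} (ω : Fin m → Bool) (Hs : List (List (Fin m))) : Set where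
  field
    F         : List (List (Fin m))
    ω′        : Fin m → Bool
    ω′⊆ω      : ∀ {i} → ω′ i ≡ true → ω i ≡ true
    covered   : ∀ {i} → ω i ≡ true → ω′ i ≡ true ⊎ ∃ λ H → H ∈ F × i ∈ H
    F⊆Hs      : ∀ {H} → H ∈ F → H ∈ Hs
    F-on      : ∀ {H i} → H ∈ F → i ∈ H → ω i ≡ true
    disjoint  : ∀ {H H′ i} → H ∈ F → H′ ∈ F → i ∈ H → i ∈ H′ → H ≡ H′
    maximal   : ∀ {H} → H ∈ Hs → ¬ AllOn ω′ H
open Packing

remove : ∀ {m} → (Fin m → Bool) → List (Fin m) → Fin m → Bool
remove ω H i with any? (i Fin.≟_) H
... | yes _ = false
... | no _  = ω i

remove⇒ : ∀ {m} (ω : Fin m → Bool) H {i} → remove ω H i ≡ true → i ∉ H × ω i ≡ true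
remove⇒ ω H {i} e with any? (i Fin.≟_) H
... | no i∉H = i∉H , e

remove-∉ : ∀ {m} (ω : Fin m → Bool) H {i} → i ∉ H → remove ω H i ≡ ω i
remove-∉ ω H {i} i∉H with any? (i Fin.≟_) H
... | yes i∈H = contradiction i∈H i∉H
... | no _    = refl

-- Greedy choice along the list. A set that is skipped stays broken, because later deletions only
-- shrink ω; a chosen set loses all its coordinates, and being nonempty it is broken too.
packing : ∀ {m} (ω : Fin m → Bool) Hs → (∀ {H} → H ∈ Hs → 0 < length H) → Packing ω Hs
packing ω [] _ = record
  { F = [] ; ω′ = ω ; ω′⊆ω = λ e → e ; covered = inj₁ ; F⊆Hs = λ () ; F-on = λ ()
  ; disjoint = λ () ; maximal = λ () }
packing ω (H ∷ Hs) nonempty with allOn? ω H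
... | no ¬on = let p = packing ω Hs (nonempty ∘ there) in record
  { F = F p ; ω′ = ω′ p ; ω′⊆ω = ω′⊆ω p ; covered = covered p ; F⊆Hs = there ∘ F⊆Hs p
  ; F-on = F-on p ; disjoint = disjoint p
  ; maximal = λ { (here refl) on′ → ¬on (All.map (ω′⊆ω p) on′) ; (there H∈) → maximal p H∈ } }
... | yes on′ = record
  { F = H ∷ F p ; ω′ = ω′ p ; ω′⊆ω = proj₂ ∘ remove⇒ ω H ∘ ω′⊆ω p ; covered = covered′
  ; F⊆Hs = λ { (here refl) → here refl ; (there H∈) → there (F⊆Hs p H∈) }
  ; F-on = λ { (here refl) i∈H → All.lookup on′ i∈H
             ; (there H∈) i∈ → proj₂ (remove⇒ ω H (F-on p H∈ i∈)) }
  ; disjoint = λ { (here refl) (here refl) _ _ → refl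
                 ; (here refl) (there H′∈) i∈H i∈H′ → contradiction i∈H (avoids H′∈ i∈H′)
                 ; (there H′∈) (here refl) i∈H′ i∈H → contradiction i∈H (avoids H′∈ i∈H′)
                 ; (there H∈) (there H′∈) → disjoint p H∈ H′∈ }
  ; maximal = λ { (here refl) → H-broken H (λ i∈H e → proj₁ (remove⇒ ω H (ω′⊆ω p e)) i∈H)
                                  (nonempty (here refl))
                ; (there H∈) → maximal p H∈ } }
  where
  p = packing (remove ω H) Hs (nonempty ∘ there)
  avoids : ∀ {H′ i} → H′ ∈ F p → i ∈ H′ → i ∉ H
  avoids H′∈ i∈H′ = proj₁ (remove⇒ ω H (F-on p H′∈ i∈H′))
  covered′ : ∀ {i} → ω i ≡ true → ω′ p i ≡ true ⊎ ∃ λ H′ → H′ ∈ H ∷ F p × i ∈ H′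
  covered′ {i} ωi with any? (i Fin.≟_) H
  ... | yes i∈H = inj₂ (H , here refl , i∈H)
  ... | no i∉H with covered p (trans (remove-∉ ω H i∉H) ωi)
  ...   | inj₁ e = inj₁ e
  ...   | inj₂ (H′ , H′∈ , i∈H′) = inj₂ (H′ , there H′∈ , i∈H′)
  H-broken : ∀ K → (∀ {i} → i ∈ K → ω′ p i ≢ true) → 0 < length K → ¬ AllOn (ω′ p) K
  H-broken (i ∷ _) K-off _ (e ∷ _) = K-off (here refl) e

-- Deletion and the union bound

module Alteration (a : ℕ) where
  open Weighted a

  mark : ∀ {m} → List (Fin m) → State m
  mark []      = const free
  mark (i ∷ P) = set (mark P) i pending

  mark-∉ : ∀ {m} (P : List (Fin m)) {i} → i ∉ P → mark P i ≡ free
  mark-∉ []      _  = refl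
  mark-∉ (j ∷ P) i∉ = trans (set-other (mark P) pending (i∉ ∘ here)) (mark-∉ P (i∉ ∘ there))

  mark-∈ : ∀ {m} (P : List (Fin m)) {i} → i ∈ P → mark P i ≡ pending
  mark-∈ (j ∷ P) {i} i∈ with i Fin.≟ j
  ... | yes refl = set-same (mark P) i pending
  mark-∈ (j ∷ P) {i} (here i≡j)  | no i≢j = contradiction i≡j i≢j
  mark-∈ (j ∷ P) {i} (there i∈P) | no i≢j =
    trans (set-other (mark P) pending i≢j) (mark-∈ P i∈P)

  mark-weight : ∀ {m} (P : List (Fin m)) → Unique P →
    weight (mark P) * (2 + a) ^ length P ≡ (1 + a) ^ length P * (2 + a) ^ m
  mark-weight {m} [] _ = begin
    weight {m} (const free) * 1 ≡⟨ *-identityʳ _ ⟩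
    weight {m} (const free)     ≡⟨ ∏-const m (2 + a) ⟩
    (2 + a) ^ m                 ≡⟨ +-identityʳ _ ⟨
    1 * (2 + a) ^ m             ∎
    where open ≡-Reasoning
  mark-weight {m} (i ∷ P) (i∉P ∷ unique) = begin
    weight c′ * ((2 + a) * (2 + a) ^ length P)
      ≡⟨ *-assoc (weight c′) _ _ ⟨
    weight c′ * (2 + a) * (2 + a) ^ length P
      ≡⟨ cong (λ z → weight c′ * cellWeight z * (2 + a) ^ length P)
              (mark-∉ P (λ i∈P → All.lookup i∉P i∈P refl)) ⟨
    weight c′ * cellWeight (mark P i) * (2 + a) ^ length P
      ≡⟨ cong (_* (2 + a) ^ length P) (∏-set cellWeight (mark P) i pending) ⟩
    (1 + a) * weight (mark P) * (2 + a) ^ length P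
      ≡⟨ *-assoc (1 + a) (weight (mark P)) _ ⟩
    (1 + a) * (weight (mark P) * (2 + a) ^ length P)
      ≡⟨ cong ((1 + a) *_) (mark-weight P unique) ⟩
    (1 + a) * ((1 + a) ^ length P * (2 + a) ^ m)
      ≡⟨ *-assoc (1 + a) ((1 + a) ^ length P) _ ⟨
    (1 + a) * (1 + a) ^ length P * (2 + a) ^ m ∎
    where
    open ≡-Reasoning
    c′ = set (mark P) i pending

  module _ {m : ℕ} (Hs : List (List (Fin m))) (𝓗 : Fin m → List (List (Fin m)))
           (Hs⊆𝓗 : ∀ {H f} → H ∈ Hs → f ∈ H → H ∈ 𝓗 f)
           (Hs-nonempty : ∀ {H} → H ∈ Hs → 0 < length H)
           (Hs-unique : ∀ {H} → H ∈ Hs → Unique H)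
           (sparse : ∀ f → Sparse (𝓗 f))
           (Ps : List (List (Fin m))) (M : ℕ)
           (Ps-unique : ∀ {P} → P ∈ Ps → Unique P)
           (Ps-length : ∀ {P} → P ∈ Ps → length P ≡ M)
           (few : length Ps * (1 + a) ^ M < (2 + a) ^ M)
    where
    open Branching 𝓗

    branches : List (List (Fin m)) → List (State m)
    branches = concatMap (λ P → branch (mark P) P)

    branches-weight : ∀ Qs → (∀ {P} → P ∈ Qs → Unique P) → (∀ {P} → P ∈ Qs → length P ≡ M) →
      totalWeight (branches Qs) * (2 + a) ^ M ≤ length Qs * (1 + a) ^ M * (2 + a) ^ m
    branches-weight [] _ _ = z≤n
    branches-weight (P ∷ Qs) unique len = begin
      totalWeight (branch (mark P) P ++ branches Qs) * (2 + a) ^ M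
        ≡⟨ cong (_* (2 + a) ^ M) (totalWeight-++ (branch (mark P) P) _) ⟩
      (totalWeight (branch (mark P) P) + totalWeight (branches Qs)) * (2 + a) ^ M
        ≡⟨ *-distribʳ-+ ((2 + a) ^ M) (totalWeight (branch (mark P) P)) _ ⟩
      totalWeight (branch (mark P) P) * (2 + a) ^ M + totalWeight (branches Qs) * (2 + a) ^ M
        ≤⟨ +-mono-≤ (*-monoˡ-≤ ((2 + a) ^ M) (branch-weight sparse (mark P) P))
                    (branches-weight Qs (unique ∘ there) (len ∘ there)) ⟩
      weight (mark P) * (2 + a) ^ M + length Qs * (1 + a) ^ M * (2 + a) ^ m
        ≡⟨ cong (_+ length Qs * (1 + a) ^ M * (2 + a) ^ m)
             (subst (λ k → weight (mark P) * (2 + a) ^ k ≡ (1 + a) ^ k * (2 + a) ^ m)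
                    (len (here refl)) (mark-weight P (unique (here refl)))) ⟩
      (1 + a) ^ M * (2 + a) ^ m + length Qs * (1 + a) ^ M * (2 + a) ^ m
        ≡⟨ *-distribʳ-+ ((2 + a) ^ m) ((1 + a) ^ M) _ ⟨
      ((1 + a) ^ M + length Qs * (1 + a) ^ M) * (2 + a) ^ m ∎
      where open ≤-Reasoning

    -- Union bound: each P accounts for at most the fraction ((1 + a) / (2 + a)) ^ M of the whole,
    -- and by `few` all of `Ps` together stay below one.
    branches-light : totalWeight (branches Ps) < (2 + a) ^ m
    branches-light = *-cancelʳ-< ((2 + a) ^ M) _ _ (begin-strict
      totalWeight (branches Ps) * (2 + a) ^ M  ≤⟨ branches-weight Ps Ps-unique Ps-length ⟩
      length Ps * (1 + a) ^ M * (2 + a) ^ m    <⟨ *-monoˡ-< ((2 + a) ^ m) few ⟩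
      (2 + a) ^ M * (2 + a) ^ m                ≡⟨ *-comm ((2 + a) ^ M) _ ⟩
      (2 + a) ^ m * (2 + a) ^ M                ∎)
      where
      open ≤-Reasoning
      instance
        nonZero : NonZero ((2 + a) ^ m)
        nonZero = m^n≢0 (2 + a) m

    -- If the deletion left no coordinate of P, each would be off in ω or lie in a member of the
    -- packing. Then `branch-complete`, started from `mark P`, would give a state of `branches Ps`
    -- matched by ω, which `avoid` excludes.
    alteration : ∃ λ (ω : Fin m → Bool) → (∀ {H} → H ∈ Hs → ¬ AllOn ω H) ×
                   (∀ {P} → P ∈ Ps → ∃ λ i → i ∈ P × ω i ≡ true)
    alteration with avoid (branches Ps) branches-light
    ... | ω , avoids = ω′ p , maximal p , meets
      where
      p = packing ω Hs Hs-nonempty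
      meets : ∀ {P} → P ∈ Ps → ∃ λ i → i ∈ P × ω′ p i ≡ true
      meets {P} P∈Ps with any? (λ i → ω′ p i Bool.≟ true) P
      ... | yes hit = find hit
      ... | no miss with branch-complete ω (F p) (F-on p) (Hs-unique ∘ F⊆Hs p) (disjoint p)
                           (Hs⊆𝓗 ∘ F⊆Hs p) (mark P) P P-covered consistent
        where
        P-covered : ∀ {f} → f ∈ P → ω f ≡ true → ∃ λ H → H ∈ F p × f ∈ H
        P-covered f∈P ωf with covered p ωf
        ... | inj₁ hit = contradiction (lose f∈P hit) miss
        ... | inj₂ H   = H
        not-marked : ∀ {i x} → x ≢ free → x ≢ pending → mark P i ≢ x
        not-marked {i} x≢free x≢pending e with any? (i Fin.≟_) P
        ... | yes i∈P = x≢pending (trans (sym e) (mark-∈ P i∈P))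
        ... | no i∉P  = x≢free (trans (sym e) (mark-∉ P i∉P))
        consistent : Consistent ω (F p) (F-on p) (Hs-unique ∘ F⊆Hs p) (disjoint p)
                       (Hs⊆𝓗 ∘ F⊆Hs p) (mark P) P
        consistent = record
          { on⇒ = λ e → contradiction e (not-marked (λ ()) (λ ()))
          ; on-full = λ _ _ _ e → contradiction e (not-marked (λ ()) (λ ()))
          ; off⇒ = λ e → contradiction e (not-marked (λ ()) (λ ()))
          ; pending⇒ = λ {i} e → marked i e }
          where
          marked : ∀ i → mark P i ≡ pending → i ∈ P
          marked i e with any? (i Fin.≟_) P
          ... | yes i∈P = i∈P
          ... | no i∉P  = contradiction (trans (sym e) (mark-∉ P i∉P)) λ ()
      ...   | c , c∈ , match = contradiction match (avoids (∈-concatMap⁺ _ (lose P∈Ps c∈)))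

-- Patterns and their copies

Links : ℕ → Set
Links v = List (Fin v × Fin v)

Ordered : ∀ {v} → Links v → Set
Ordered = All (λ (i , j) → i Fin.< j)

pairs : ∀ v → Links v
pairs zero    = []
pairs (suc v) = map (λ j → zero , suc j) (allFin v) ++ map (λ (i , j) → suc i , suc j) (pairs v)

length-allFin : ∀ n → length (allFin n) ≡ n
length-allFin n = length-tabulate {n = n} (λ i → i)

length-pairs : ∀ v → length (pairs (suc v)) ≡ v + length (pairs v)
length-pairs v = trans (length-++ (map (λ j → zero , suc j) (allFin v)))
  (cong₂ _+_ (trans (length-map _ (allFin v)) (length-allFin v)) (length-map _ (pairs v)))

pairs-ordered : ∀ v → Ordered (pairs v)
pairs-ordered zero    = []
pairs-ordered (suc v) = Allₚ.++⁺ (Allₚ.map⁺ (All.universal (λ _ → s≤s z≤n) (allFin v)))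
                                 (Allₚ.map⁺ (All.map s≤s (pairs-ordered v)))

pairs-unique : ∀ v → Unique (pairs v)
pairs-unique zero    = []
pairs-unique (suc v) = Uniqueₚ.++⁺
  (Uniqueₚ.map⁺ (λ { refl → refl }) (Uniqueₚ.allFin⁺ v))
  (Uniqueₚ.map⁺ (λ { refl → refl }) (pairs-unique v))
  λ (p , q) → apart (∈-map⁻ _ p) (∈-map⁻ _ q)
  where
  apart : ∀ {x} → (∃ λ j → j ∈ allFin v × x ≡ (zero , suc j)) →
          ¬ ∃ λ y → y ∈ pairs v × x ≡ (suc (proj₁ y) , suc (proj₂ y))
  apart (_ , _ , refl) (_ , _ , ())

length-product : ∀ {A B C : Set} (f : A → B → C) xs ys →
                 length (cartesianProductWith f xs ys) ≡ length xs * length ys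
length-product f []       ys = refl
length-product f (x ∷ xs) ys = trans (length-++ (map (f x) ys))
  (cong₂ _+_ (length-map (f x) ys) (length-product f xs ys))

-- The complete bipartite graph on two classes of size k + 1 without a perfect matching.
crown : ∀ k → Links (suc k + suc k)
crown k = cartesianProductWith (λ i j → i ↑ˡ suc k , suc k ↑ʳ punchIn i j) (allFin (suc k)) (allFin k)

length-crown : ∀ k → length (crown k) ≡ suc k * k
length-crown k = trans (length-product _ (allFin (suc k)) (allFin k))
                       (cong₂ _*_ (length-allFin (suc k)) (length-allFin k))

crown-∈⁻ : ∀ k {l} → l ∈ crown k → ∃ λ i → ∃ λ j → l ≡ (i ↑ˡ suc k , suc k ↑ʳ punchIn i j)
crown-∈⁻ k l∈ with ∈-cartesianProductWith⁻ (λ i j → i ↑ˡ suc k , suc k ↑ʳ punchIn i j)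
                     (allFin (suc k)) (allFin k) l∈
... | i , j , _ , _ , l≡ = i , j , l≡

crown-ordered : ∀ k → Ordered (crown k)
crown-ordered k = All.tabulate (ordered ∘ crown-∈⁻ k)
  where
  ordered : ∀ {l} → (∃ λ i → ∃ λ j → l ≡ (i ↑ˡ suc k , suc k ↑ʳ punchIn i j)) →
            proj₁ l Fin.< proj₂ l
  ordered (i , j , refl) = begin-strict
    toℕ (i ↑ˡ suc k)              ≡⟨ Finₚ.toℕ-↑ˡ i (suc k) ⟩
    toℕ i                         <⟨ Finₚ.toℕ<n i ⟩
    suc k                         ≤⟨ m≤m+n (suc k) _ ⟩
    suc k + toℕ (punchIn i j)     ≡⟨ Finₚ.toℕ-↑ʳ (suc k) (punchIn i j) ⟨
    toℕ (suc k ↑ʳ punchIn i j)    ∎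
    where open ≤-Reasoning

crown-unique : ∀ k → Unique (crown k)
crown-unique k = Uniqueₚ.cartesianProductWith⁺ _ split (Uniqueₚ.allFin⁺ (suc k)) (Uniqueₚ.allFin⁺ k)
  where
  split : ∀ {i i′ : Fin (suc k)} {j j′ : Fin k} →
          (i ↑ˡ suc k , suc k ↑ʳ punchIn i j) ≡ (i′ ↑ˡ suc k , suc k ↑ʳ punchIn i′ j′) →
          i ≡ i′ × j ≡ j′
  split {i} {i′} {j} {j′} e with ,-injective e
  ... | e₁ , e₂ with Finₚ.↑ˡ-injective (suc k) i i′ e₁
  ...   | refl = refl , Finₚ.punchIn-injective i j j′ (Finₚ.↑ʳ-injective (suc k) _ _ e₂)

vectors : ∀ {A : Set} {v} → (Fin v → List A) → List (Vec A v)
vectors {v = zero}  S = Vec.[] ∷ []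
vectors {v = suc v} S = cartesianProductWith Vec._∷_ (S zero) (vectors (S ∘ suc))

length-vectors : ∀ {A : Set} {v} (S : Fin v → List A) → length (vectors S) ≡ ∏ (length ∘ S)
length-vectors {v = zero}  S = refl
length-vectors {v = suc v} S =
  trans (length-product Vec._∷_ (S zero) _) (cong (length (S zero) *_) (length-vectors (S ∘ suc)))

∈-vectors : ∀ {A : Set} {v} (S : Fin v → List A) (τ : Vec A v) →
            (∀ i → lookup τ i ∈ S i) → τ ∈ vectors S
∈-vectors S Vec.[]      _  = here refl
∈-vectors S (x Vec.∷ τ) τ∈ = ∈-cartesianProductWith⁺ Vec._∷_ (τ∈ zero) (∈-vectors (S ∘ suc) τ (τ∈ ∘ suc))

module _ {n : ℕ} where

  -- Codes of unordered pairs: only one of the two coordinates of a pair is used.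
  code : Fin n → Fin n → Fin (n * n)
  code u v with u Fin.<? v
  ... | yes _ = combine u v
  ... | no _  = combine v u

  code-cases : ∀ u v → code u v ≡ combine u v ⊎ code u v ≡ combine v u
  code-cases u v with u Fin.<? v
  ... | yes _ = inj₁ refl
  ... | no _  = inj₂ refl

  code-sym : ∀ u v → code u v ≡ code v u
  code-sym u v with u Fin.<? v | v Fin.<? u
  ... | yes u<v | yes v<u = contradiction v<u (<-asym u<v)
  ... | yes _   | no _    = refl
  ... | no _    | yes _   = refl
  ... | no u≮v  | no v≮u  with refl ← Finₚ.≤-antisym (≮⇒≥ v≮u) (≮⇒≥ u≮v) = refl

  SamePair : Fin n → Fin n → Fin n → Fin n → Set
  SamePair u v x y = (u ≡ x × v ≡ y) ⊎ (u ≡ y × v ≡ x)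

  combine-code : ∀ {u v} x y → combine u v ≡ code x y → SamePair x y u v
  combine-code {u} {v} x y e with code-cases x y
  ... | inj₁ c with Finₚ.combine-injective u v x y (trans e c)
  ...   | refl , refl = inj₁ (refl , refl)
  combine-code {u} {v} x y e | inj₂ c with Finₚ.combine-injective u v y x (trans e c)
  ...   | refl , refl = inj₂ (refl , refl)

  code-injective : ∀ u v x y → code u v ≡ code x y → SamePair u v x y
  code-injective u v x y e with code-cases u v
  ... | inj₁ c with combine-code x y (trans (sym c) e)
  ...   | inj₁ (refl , refl) = inj₁ (refl , refl)
  ...   | inj₂ (refl , refl) = inj₂ (refl , refl)
  code-injective u v x y e | inj₂ c with combine-code x y (trans (sym c) e)
  ...   | inj₁ (refl , refl) = inj₂ (refl , refl)
  ...   | inj₂ (refl , refl) = inj₁ (refl , refl)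

  copy : ∀ {v} → Vec (Fin n) v → Links v → List (Fin (n * n))
  copy τ = map (λ (i , j) → code (lookup τ i) (lookup τ j))

  -- Under an injective map two links share a code only if they are equal or reverse to each other,
  -- and `Ordered` excludes the reversal.
  copy-unique : ∀ {v} (τ : Vec (Fin n) v) → Injective _≡_ _≡_ (lookup τ) → ∀ {L} →
                Unique L → Ordered L → Unique (copy τ L)
  copy-unique τ inj [] [] = []
  copy-unique τ inj {(i , j) ∷ L} (ij∉L ∷ unique) (i<j ∷ ordered) =
    Allₚ.map⁺ (All.zipWith (λ {x} → distinct x) (ij∉L , ordered)) ∷ copy-unique τ inj unique ordered
    where
    distinct : ∀ x → (i , j) ≢ x × proj₁ x Fin.< proj₂ x →
               code (lookup τ i) (lookup τ j) ≢ code (lookup τ (proj₁ x)) (lookup τ (proj₂ x))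
    distinct (k , l) (ij≢kl , k<l) e with code-injective _ _ _ _ e
    ... | inj₁ (p , q) = ij≢kl (cong₂ _,_ (inj p) (inj q))
    ... | inj₂ (p , q) with inj p | inj q
    ...   | refl | refl = <-asym i<j k<l

  tuples : ∀ v → List (Vec (Fin n) v)
  tuples v = vectors {v = v} (const (allFin n))

  copies : ∀ {v} → Links v → List (List (Fin (n * n)))
  copies {v} L = map (λ τ → copy τ L) (tuples v)

  -- The filter tests the codes rather than the vertices, since branching needs lists without
  -- repetition. Degenerate copies that pass are kept; the counts below run over all tuples and
  -- include them.
  distinctCopies : ∀ {v} → Links v → List (List (Fin (n * n)))
  distinctCopies L = filter (DecUnique.unique? Fin._≟_) (copies L)

  distinctCopies-unique : ∀ {v} (L : Links v) {H} → H ∈ distinctCopies L → Unique H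
  distinctCopies-unique L H∈ = proj₂ (∈-filter⁻ (DecUnique.unique? Fin._≟_) {xs = copies L} H∈)

  distinctCopies⁻ : ∀ {v} (L : Links v) {H} → H ∈ distinctCopies L → ∃ λ τ → H ≡ copy τ L
  distinctCopies⁻ {v} L H∈
    with ∈-map⁻ (λ τ → copy τ L) {xs = tuples v}
           (proj₁ (∈-filter⁻ (DecUnique.unique? Fin._≟_) {xs = copies L} H∈))
  ... | τ , _ , H≡ = τ , H≡

  distinctCopies⁺ : ∀ {v} {L : Links v} τ → Unique L → Ordered L → Injective _≡_ _≡_ (lookup τ) →
                    copy τ L ∈ distinctCopies L
  distinctCopies⁺ τ unique ordered inj = ∈-filter⁺ (DecUnique.unique? Fin._≟_)
    (∈-map⁺ _ (∈-vectors _ τ (λ _ → ∈-allFin _))) (copy-unique τ inj unique ordered)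

  length-distinctCopies : ∀ {v} (L : Links v) {H} → H ∈ distinctCopies L → length H ≡ length L
  length-distinctCopies L H∈ with distinctCopies⁻ L H∈
  ... | τ , refl = length-map _ L

  number-tuples : ∀ v → length (tuples v) ≡ n ^ v
  number-tuples v = begin
    length (tuples v)               ≡⟨ length-vectors {v = v} (const (allFin n)) ⟩
    ∏ {v} (const (length (allFin n))) ≡⟨ ∏-const v (length (allFin n)) ⟩
    length (allFin n) ^ v           ≡⟨ cong (_^ v) (length-allFin n) ⟩
    n ^ v                           ∎
    where open ≡-Reasoning

  number-distinctCopies : ∀ {v} (L : Links v) → length (distinctCopies L) ≤ n ^ v
  number-distinctCopies {v} L = begin
    length (distinctCopies L) ≤⟨ length-filter (DecUnique.unique? Fin._≟_) (copies L) ⟩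
    length (copies L)         ≡⟨ length-map (λ τ → copy τ L) (tuples v) ⟩
    length (tuples v)         ≡⟨ number-tuples v ⟩
    n ^ v                     ∎
    where open ≤-Reasoning

  -- Copies through a given pair

  pinned : ∀ {v} → Fin v × Fin v → Fin n → Fin n → List (Vec (Fin n) v)
  pinned (i , j) x y = vectors (set (set (const (allFin n)) i (x ∷ [])) j (y ∷ []))

  ∈-pinned : ∀ {v} (i j : Fin v) τ → τ ∈ pinned (i , j) (lookup τ i) (lookup τ j)
  ∈-pinned i j τ = ∈-vectors _ τ member
    where
    S₁ = set (const (allFin n)) i (lookup τ i ∷ [])
    member : ∀ k → lookup τ k ∈ set S₁ j (lookup τ j ∷ []) k
    member k with k Fin.≟ j
    ... | yes refl = subst (lookup τ k ∈_) (sym (set-same S₁ k _)) (here refl)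
    ... | no k≢j with k Fin.≟ i
    ...   | yes refl = subst (lookup τ k ∈_)
                         (sym (trans (set-other S₁ _ k≢j) (set-same (const (allFin n)) k _))) (here refl)
    ...   | no k≢i   = subst (lookup τ k ∈_)
                         (sym (trans (set-other S₁ _ k≢j) (set-other (const (allFin n)) _ k≢i))) (∈-allFin _)

  -- By `∏-set`, each pinned entry trades its factor n for 1; the product with `n * n` clears the
  -- division. As i and j differ, the second pin leaves the first intact.
  number-pinned : .{{_ : NonZero n}} → ∀ {v} {i j : Fin (2 + v)} → i Fin.< j → ∀ x y →
                  length (pinned (i , j) x y) ≡ n ^ v
  number-pinned {v = v} {i} {j} i<j x y = *-cancelʳ-≡ (length (pinned (i , j) x y)) _ (n * n) (begin
    length (pinned (i , j) x y) * (n * n)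
      ≡⟨ *-assoc (length (pinned (i , j) x y)) n n ⟨
    length (pinned (i , j) x y) * n * n
      ≡⟨ cong (λ z → z * n * n) (length-vectors (set S₁ j (y ∷ []))) ⟩
    ∏ (length ∘ set S₁ j (y ∷ [])) * n * n
      ≡⟨ cong (λ z → ∏ (length ∘ set S₁ j (y ∷ [])) * z * n) (sym
           (trans (cong length (set-other (const (allFin n)) {i} {j} (x ∷ []) (λ { refl → <-irrefl refl i<j })))
                  (length-allFin n))) ⟩
    ∏ (length ∘ set S₁ j (y ∷ [])) * length (S₁ j) * n
      ≡⟨ cong (_* n) (∏-set length S₁ j (y ∷ [])) ⟩
    1 * ∏ (length ∘ S₁) * n
      ≡⟨ cong₂ _*_ (*-identityˡ (∏ (length ∘ S₁))) (sym (length-allFin n)) ⟩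
    ∏ (length ∘ S₁) * length (allFin n)
      ≡⟨ ∏-set length (const (allFin n)) i (x ∷ []) ⟩
    1 * ∏ {2 + v} (const (length (allFin n)))
      ≡⟨ *-identityˡ _ ⟩
    ∏ {2 + v} (const (length (allFin n)))
      ≡⟨ length-vectors {v = 2 + v} (const (allFin n)) ⟨
    length (tuples (2 + v))
      ≡⟨ number-tuples (2 + v) ⟩
    n * (n * n ^ v)
      ≡⟨ shuffle n (n ^ v) ⟩
    n ^ v * (n * n) ∎)
    where
    open ≡-Reasoning
    instance
      nonZero : NonZero (n * n)
      nonZero = m*n≢0 n n
    S₁ = set (const (allFin n)) i (x ∷ [])
    shuffle : ∀ p q → p * (p * q) ≡ q * (p * p)
    shuffle = solve-∀

  -- Both orientations are listed because `code` forgets the order of a pair; hence the factor 2 in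
  -- the count. Repeated or degenerate tuples only enlarge the list, which serves for upper bounds.
  placements : ∀ {v} → Links v → Fin n → Fin n → List (Vec (Fin n) v)
  placements K x y = concatMap (λ l → pinned l x y ++ pinned l y x) K

  number-placements : .{{_ : NonZero n}} → ∀ {v} {K : Links (2 + v)} → Ordered K → ∀ x y →
                      length (placements K x y) ≡ length K * (2 * n ^ v)
  number-placements [] x y = refl
  number-placements {v} {l ∷ K} (i<j ∷ ordered) x y = begin
    length ((pinned l x y ++ pinned l y x) ++ placements K x y)
      ≡⟨ length-++ (pinned l x y ++ pinned l y x) ⟩
    length (pinned l x y ++ pinned l y x) + length (placements K x y)
      ≡⟨ cong₂ _+_ (trans (length-++ (pinned l x y))
                     (cong₂ _+_ (number-pinned i<j x y) (number-pinned i<j y x)))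
                   (number-placements ordered x y) ⟩
    (n ^ v + n ^ v) + length K * (2 * n ^ v)
      ≡⟨ cong (λ z → (n ^ v + z) + length K * (2 * n ^ v)) (+-identityʳ (n ^ v)) ⟨
    2 * n ^ v + length K * (2 * n ^ v) ∎
    where open ≡-Reasoning

  copiesThrough : ∀ {v} → Links v → Fin (n * n) → List (List (Fin (n * n)))
  copiesThrough L f = map (λ τ → copy τ L) (uncurry (placements L) (remQuot n f))

  number-copiesThrough : .{{_ : NonZero n}} → ∀ {v} {L : Links (2 + v)} → Ordered L → ∀ f →
                         length (copiesThrough L f) ≡ length L * (2 * n ^ v)
  number-copiesThrough {L = L} ordered f =
    trans (length-map _ (uncurry (placements L) (remQuot n f))) (number-placements ordered _ _)

  length-copiesThrough : ∀ {v} (L : Links v) f {H} → H ∈ copiesThrough L f → length H ≡ length L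
  length-copiesThrough L f H∈
    with ∈-map⁻ (λ τ → copy τ L) {xs = uncurry (placements L) (remQuot n f)} H∈
  ... | τ , _ , refl = length-map _ L

  ∈-copiesThrough : ∀ {v} (L : Links v) {H f} → H ∈ distinctCopies L → f ∈ H → H ∈ copiesThrough L f
  ∈-copiesThrough L {f = f} H∈ f∈H with distinctCopies⁻ L H∈
  ... | τ , refl with ∈-map⁻ _ f∈H
  ...   | (i , j) , ij∈L , f≡ = ∈-map⁺ _ (∈-concatMap⁺ _ (lose ij∈L τ∈))
    where
    x = proj₁ (remQuot {n} n f)
    y = proj₂ (remQuot {n} n f)
    τ∈ : τ ∈ pinned (i , j) x y ++ pinned (i , j) y x
    τ∈ with combine-code {x} {y} (lookup τ i) (lookup τ j) (trans (Finₚ.combine-remQuot {n} n f) f≡)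
    ... | inj₁ (p , q) = ∈-++⁺ˡ (subst₂ (λ u w → τ ∈ pinned (i , j) u w) p q (∈-pinned i j τ))
    ... | inj₂ (p , q) = ∈-++⁺ʳ (pinned (i , j) x y)
                           (subst₂ (λ u w → τ ∈ pinned (i , j) u w) p q (∈-pinned i j τ))

-- Sparseness from a bound on the number of sets

^-distribʳ-* : ∀ k m n → (m * n) ^ k ≡ m ^ k * n ^ k
^-distribʳ-* zero    m n = refl
^-distribʳ-* (suc k) m n = trans (cong (m * n *_) (^-distribʳ-* k m n)) (shuffle m n (m ^ k) (n ^ k))
  where
  shuffle : ∀ p q r s → p * q * (r * s) ≡ p * r * (q * s)
  shuffle = solve-∀

module _ (b : ℕ) .{{_ : NonZero b}} where
  open Weighted (2 * b)

  -- With a = 2b, each set weighs at most `4 * X` over `b ^ e`, because `1 + 2 * b` is at most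
  -- `b * 4`. As `8 * length L` is at most `b ^ e`, the total is at most half of X; the other half
  -- is left for a second pattern.
  half-sparse : ∀ {A : Set} e (L : List (List A)) →
    (∀ {H} → H ∈ L → length H ≡ suc e) → 8 * length L ≤ b ^ e → ∀ X (W : List A → ℕ) →
    (∀ {H} → H ∈ L → (2 * b) ^ length H * W H ≤ 2 ^ length H * ((1 + 2 * b) * X)) →
    2 * sum (map W L) ≤ X
  half-sparse e [] _ _ X W _ = z≤n
  half-sparse {A} e L@(_ ∷ _) len few X W bound = *-cancelˡ-≤ (4 * length L) (begin
    4 * length L * (2 * sum (map W L)) ≡⟨ shuffle (length L) (sum (map W L)) ⟩
    8 * length L * sum (map W L)       ≤⟨ *-monoˡ-≤ (sum (map W L)) few ⟩
    b ^ e * sum (map W L)              ≤⟨ total L (λ H∈ → each (len H∈) (bound H∈)) ⟩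
    length L * (4 * X)                 ≡⟨ regroup (length L) X ⟩
    4 * length L * X                   ∎)
    where
    open ≤-Reasoning
    shuffle : ∀ p q → 4 * p * (2 * q) ≡ 8 * p * q
    shuffle = solve-∀
    regroup : ∀ p q → p * (4 * q) ≡ 4 * p * q
    regroup = solve-∀

    each : ∀ {H} → length H ≡ suc e →
           (2 * b) ^ length H * W H ≤ 2 ^ length H * ((1 + 2 * b) * X) → b ^ e * W H ≤ 4 * X
    each {H} len≡ le rewrite len≡ =
      *-cancelˡ-≤ b (*-cancelˡ-≤ (2 ^ suc e) {{m^n≢0 2 (suc e)}} (begin
        2 ^ suc e * (b * (b ^ e * W H)) ≡⟨ cong (2 ^ suc e *_) (*-assoc b (b ^ e) (W H)) ⟨
        2 ^ suc e * (b ^ suc e * W H)   ≡⟨ *-assoc (2 ^ suc e) (b ^ suc e) (W H) ⟨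
        2 ^ suc e * b ^ suc e * W H     ≡⟨ cong (_* W H) (^-distribʳ-* (suc e) 2 b) ⟨
        (2 * b) ^ suc e * W H           ≤⟨ le ⟩
        2 ^ suc e * ((1 + 2 * b) * X)   ≤⟨ *-monoʳ-≤ (2 ^ suc e) (*-monoˡ-≤ X three) ⟩
        2 ^ suc e * (b * 4 * X)         ≡⟨ cong (2 ^ suc e *_) (*-assoc b 4 X) ⟩
        2 ^ suc e * (b * (4 * X))       ∎))
      where
      add : ∀ p → (p + p) + 2 * p ≡ p * 4
      add = solve-∀
      three : 1 + 2 * b ≤ b * 4
      three = ≤-trans (+-monoˡ-≤ (2 * b) (≤-trans (>-nonZero⁻¹ b) (m≤m+n b b))) (≤-reflexive (add b))

    total : ∀ K → (∀ {H} → H ∈ K → b ^ e * W H ≤ 4 * X) → b ^ e * sum (map W K) ≤ length K * (4 * X)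
    total []      _ = ≤-reflexive (*-zeroʳ (b ^ e))
    total (H ∷ K) h = ≤-trans (≤-reflexive (*-distribˡ-+ (b ^ e) (W H) _))
                              (+-mono-≤ (h (here refl)) (total K (h ∘ there)))

  sparse-++ : ∀ {A : Set} e₁ e₂ (K L : List (List A)) →
    (∀ {H} → H ∈ K → length H ≡ suc e₁) → 8 * length K ≤ b ^ e₁ →
    (∀ {H} → H ∈ L → length H ≡ suc e₂) → 8 * length L ≤ b ^ e₂ → Sparse (K ++ L)
  sparse-++ e₁ e₂ K L lenK fewK lenL fewL X W bound = *-cancelˡ-≤ 2 (begin
    2 * sum (map W (K ++ L))
      ≡⟨ cong (2 *_) (trans (cong sum (map-++ W K L)) (sum-++ (map W K) _)) ⟩
    2 * (sum (map W K) + sum (map W L))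
      ≡⟨ *-distribˡ-+ 2 (sum (map W K)) _ ⟩
    2 * sum (map W K) + 2 * sum (map W L)
      ≤⟨ +-mono-≤ (half-sparse e₁ K lenK fewK X W (bound ∘ ∈-++⁺ˡ))
                  (half-sparse e₂ L lenL fewL X W (bound ∘ ∈-++⁺ʳ K)) ⟩
    X + X ≡⟨ cong (X +_) (+-identityʳ X) ⟨
    2 * X ∎)
    where open ≤-Reasoning

-- Numerical estimates

bernoulli : ∀ b k → b ^ k * (b + k) ≤ (1 + b) ^ k * b
bernoulli b zero    = ≤-reflexive (cong (1 *_) (+-identityʳ b))
bernoulli b (suc k) = begin
  b * b ^ k * (b + suc k)                   ≡⟨ expand b (b ^ k) k ⟩
  b ^ k * b + b * (b ^ k * (b + k))         ≤⟨ +-monoˡ-≤ (b * (b ^ k * (b + k)))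
                                                 (*-monoʳ-≤ (b ^ k) (m≤m+n b k)) ⟩
  (1 + b) * (b ^ k * (b + k))               ≤⟨ *-monoʳ-≤ (1 + b) (bernoulli b k) ⟩
  (1 + b) * ((1 + b) ^ k * b)               ≡⟨ *-assoc (1 + b) ((1 + b) ^ k) b ⟨
  (1 + b) * (1 + b) ^ k * b                 ∎
  where
  open ≤-Reasoning
  expand : ∀ p q r → p * q * (p + (1 + r)) ≡ q * p + p * (q * (p + r))
  expand = solve-∀

doubling : ∀ b .{{_ : NonZero b}} → 2 * b ^ b ≤ (1 + b) ^ b
doubling b = *-cancelʳ-≤ _ _ b (≤-trans (≤-reflexive (shuffle b (b ^ b))) (bernoulli b b))
  where
  shuffle : ∀ p q → 2 * q * p ≡ q * (p + p)
  shuffle = solve-∀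

n<2^[1+⌊log₂n⌋] : ∀ n → n < 2 ^ (1 + ⌊log₂ n ⌋)
n<2^[1+⌊log₂n⌋] n = ≰⇒> λ le → <-irrefl refl (begin-strict
  ⌊log₂ n ⌋                     <⟨ n<1+n _ ⟩
  1 + ⌊log₂ n ⌋                 ≡⟨ ⌊log₂[2^n]⌋≡n (1 + ⌊log₂ n ⌋) ⟨
  ⌊log₂ 2 ^ (1 + ⌊log₂ n ⌋) ⌋   ≤⟨ ⌊log₂⌋-mono-≤ le ⟩
  ⌊log₂ n ⌋                     ∎)
  where open ≤-Reasoning

-- The least suitable x is found by descending from N. The power of its predecessor y is too small,
-- and for positive y the step to `1 + y` at most doubles y. With N = n² this makes x comparable to
-- n^(2/(s + 1)).
approximateRoot : ∀ k N → 1 ≤ N → ∃ λ x → 1 ≤ x × N ≤ x ^ suc k × x ^ suc k ≤ 2 ^ suc k * N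
approximateRoot k N 1≤N = search N (m≤m*n N (N ^ k) {{m^n≢0 N k {{>-nonZero 1≤N}}}})
  where
  open ≤-Reasoning
  close : ∀ y → y ^ suc k < N → (1 + y) ^ suc k ≤ 2 ^ suc k * N
  close zero lt = begin
    1 ^ suc k     ≡⟨ ^-zeroˡ (suc k) ⟩
    1             ≤⟨ *-mono-≤ (m^n>0 2 (suc k)) 1≤N ⟩
    2 ^ suc k * N ∎
  close y@(suc y′) lt = begin
    (1 + y) ^ suc k         ≤⟨ ^-monoˡ-≤ (suc k) (≤-trans (+-monoˡ-≤ y (s≤s z≤n))
                                 (≤-reflexive (cong (y +_) (sym (+-identityʳ y))))) ⟩
    (2 * y) ^ suc k         ≡⟨ ^-distribʳ-* (suc k) 2 y ⟩
    2 ^ suc k * y ^ suc k   ≤⟨ *-monoʳ-≤ (2 ^ suc k) (<⇒≤ lt) ⟩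
    2 ^ suc k * N           ∎
  search : ∀ y → N ≤ y ^ suc k → ∃ λ x → 1 ≤ x × N ≤ x ^ suc k × x ^ suc k ≤ 2 ^ suc k * N
  search zero    le = contradiction (≤-trans 1≤N le) λ ()
  search (suc y) le with N ≤? y ^ suc k
  ... | yes le′ = search y le′
  ... | no  nle = suc y , s≤s z≤n , le , close y (≰⇒> nle)

double-length-pairs : ∀ v → 2 * length (pairs (suc v)) ≡ suc v * v
double-length-pairs zero    = refl
double-length-pairs (suc v) = begin
  2 * length (pairs (2 + v))               ≡⟨ cong (2 *_) (length-pairs (suc v)) ⟩
  2 * (suc v + length (pairs (suc v)))     ≡⟨ *-distribˡ-+ 2 (suc v) _ ⟩
  2 * suc v + 2 * length (pairs (suc v))   ≡⟨ cong (2 * suc v +_) (double-length-pairs v) ⟩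
  2 * suc v + suc v * v                    ≡⟨ shuffle v ⟩
  (2 + v) * suc v                          ∎
  where
  open ≡-Reasoning
  shuffle : ∀ p → 2 * suc p + suc p * p ≡ (2 + p) * suc p
  shuffle = solve-∀

length-pairs-odd : ∀ r → length (pairs (suc (2 * r))) ≡ r * suc (2 * r)
length-pairs-odd r = *-cancelˡ-≡ _ _ 2 (trans (double-length-pairs (2 * r)) (shuffle r))
  where
  shuffle : ∀ p → suc (2 * p) * (2 * p) ≡ 2 * (p * suc (2 * p))
  shuffle = solve-∀

-- For odd t = 2r + 1 the number of pairs is exactly r t, so the inequality is the t-th power of
-- `base`. There r consists of ℓ blocks of length b; `doubling` gains a factor 2 from each block,
-- and n is below 2 ^ ℓ.
few-tuples : ∀ n b .{{_ : NonZero b}} → let r = b * (1 + ⌊log₂ n ⌋) in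
  n ^ suc (2 * r) * b ^ length (pairs (suc (2 * r))) < (1 + b) ^ length (pairs (suc (2 * r)))
few-tuples n b = begin-strict
  n ^ t * b ^ length (pairs t)  ≡⟨ cong (λ z → n ^ t * b ^ z) (length-pairs-odd r) ⟩
  n ^ t * b ^ (r * t)           ≡⟨ cong (n ^ t *_) (^-*-assoc b r t) ⟨
  n ^ t * (b ^ r) ^ t           ≡⟨ ^-distribʳ-* t n (b ^ r) ⟨
  (n * b ^ r) ^ t               <⟨ ^-monoˡ-< t base ⟩
  ((1 + b) ^ r) ^ t             ≡⟨ ^-*-assoc (1 + b) r t ⟩
  (1 + b) ^ (r * t)             ≡⟨ cong ((1 + b) ^_) (length-pairs-odd r) ⟨
  (1 + b) ^ length (pairs t)    ∎
  where
  open ≤-Reasoning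
  ℓ = 1 + ⌊log₂ n ⌋
  r = b * ℓ
  t = suc (2 * r)
  instance
    nonZero : NonZero (b ^ r)
    nonZero = m^n≢0 b r
  base : n * b ^ r < (1 + b) ^ r
  base = begin-strict
    n * b ^ r            <⟨ *-monoˡ-< (b ^ r) (n<2^[1+⌊log₂n⌋] n) ⟩
    2 ^ ℓ * b ^ r        ≡⟨ cong (2 ^ ℓ *_) (^-*-assoc b b ℓ) ⟨
    2 ^ ℓ * (b ^ b) ^ ℓ  ≡⟨ ^-distribʳ-* ℓ 2 (b ^ b) ⟨
    (2 * b ^ b) ^ ℓ      ≤⟨ ^-monoˡ-≤ ℓ (doubling b) ⟩
    ((1 + b) ^ b) ^ ℓ    ≡⟨ ^-*-assoc (1 + b) b ℓ ⟩
    (1 + b) ^ r          ∎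

threshold : ∀ n b .{{_ : NonZero b}} → ∃ λ t →
  t ≤ 1 + 2 * (b * (1 + ⌊log₂ n ⌋)) ×
  n ^ t * b ^ length (pairs t) < (1 + b) ^ length (pairs t)
threshold n b = _ , ≤-refl , few-tuples n b

^-cancelˡ-≤ : ∀ k {m n} .{{_ : NonZero k}} → m ^ k ≤ n ^ k → m ≤ n
^-cancelˡ-≤ k le = ≮⇒≥ λ lt → <⇒≱ (^-monoˡ-< k lt) le

-- In effect n ≤ x^(q/2), so n^v ≤ x^(qv/2); both sides are squared to avoid half-integral
-- exponents.
power-transfer : ∀ {n x q v e} .{{_ : NonZero x}} → n ^ 2 ≤ x ^ q → q * v ≤ e * 2 → n ^ v ≤ x ^ e
power-transfer {n} {x} {q} {v} {e} n²≤ qv≤ = ^-cancelˡ-≤ 2 (begin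
  (n ^ v) ^ 2   ≡⟨ ^-*-assoc n v 2 ⟩
  n ^ (v * 2)   ≡⟨ cong (n ^_) (*-comm v 2) ⟩
  n ^ (2 * v)   ≡⟨ ^-*-assoc n 2 v ⟨
  (n ^ 2) ^ v   ≤⟨ ^-monoˡ-≤ v n²≤ ⟩
  (x ^ q) ^ v   ≡⟨ ^-*-assoc x q v ⟩
  x ^ (q * v)   ≤⟨ ^-monoʳ-≤ x qv≤ ⟩
  x ^ (e * 2)   ≡⟨ ^-*-assoc x e 2 ⟨
  (x ^ e) ^ 2   ∎)
  where open ≤-Reasoning

-- Absorbing the summands 1 into `K * x` and ℓ gives 2 · 3Kx · 2ℓ = 12Kxℓ; the other factor 2 in 24
-- is the rounding loss in x.
size-bound : ∀ {m n x K q ℓ} → 1 ≤ K → 1 ≤ x → 1 ≤ ℓ → m ≤ 2 * ((1 + 2 * (K * x)) * (1 + ℓ)) →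
             x ^ q ≤ 2 ^ q * n → m ^ q ≤ (24 * K) ^ q * n * ℓ ^ q
size-bound {m} {n} {x} {K} {q} {ℓ} 1≤K 1≤x 1≤ℓ m≤ xq≤ = begin
  m ^ q                             ≤⟨ ^-monoˡ-≤ q m≤12 ⟩
  (12 * K * x * ℓ) ^ q              ≡⟨ ^-distribʳ-* q (12 * K * x) ℓ ⟩
  (12 * K * x) ^ q * ℓ ^ q          ≡⟨ cong (_* ℓ ^ q) (^-distribʳ-* q (12 * K) x) ⟩
  (12 * K) ^ q * x ^ q * ℓ ^ q      ≤⟨ *-monoˡ-≤ (ℓ ^ q) (*-monoʳ-≤ ((12 * K) ^ q) xq≤) ⟩
  (12 * K) ^ q * (2 ^ q * n) * ℓ ^ q
    ≡⟨ cong (_* ℓ ^ q) (*-assoc ((12 * K) ^ q) (2 ^ q) n) ⟨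
  (12 * K) ^ q * 2 ^ q * n * ℓ ^ q
    ≡⟨ cong (λ z → z * n * ℓ ^ q) (^-distribʳ-* q (12 * K) 2) ⟨
  (12 * K * 2) ^ q * n * ℓ ^ q      ≡⟨ cong (λ z → z ^ q * n * ℓ ^ q) (shuffle K) ⟩
  (24 * K) ^ q * n * ℓ ^ q          ∎
  where
  open ≤-Reasoning
  shuffle : ∀ p → 12 * p * 2 ≡ 24 * p
  shuffle = solve-∀
  regroup : ∀ p q r → 2 * ((p * q + 2 * (p * q)) * (r + r)) ≡ 12 * p * q * r
  regroup = solve-∀
  m≤12 : m ≤ 12 * K * x * ℓ
  m≤12 = begin
    m                                          ≤⟨ m≤ ⟩
    2 * ((1 + 2 * (K * x)) * (1 + ℓ))          ≤⟨ *-monoʳ-≤ 2 (*-mono-≤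
                                                    (+-monoˡ-≤ (2 * (K * x)) (*-mono-≤ 1≤K 1≤x))
                                                    (+-monoˡ-≤ ℓ 1≤ℓ)) ⟩
    2 * ((K * x + 2 * (K * x)) * (ℓ + ℓ))      ≡⟨ regroup K x ℓ ⟩
    12 * K * x * ℓ                             ∎

-- Graphs

members : ∀ {n} (I : Subset n) {t} → t ≤ ∣ I ∣ →
          ∃ λ (f : Fin t → Fin n) → Injective _≡_ _≡_ f × (∀ k → f k ∈ˢ I)
members I {zero} _ = (λ ()) , (λ { {()} }) , λ ()
members (outside ∷ I) {suc t} t≤ with members I t≤
... | f , inj , f∈ = suc ∘ f , inj ∘ Finₚ.suc-injective , Vec.there ∘ f∈
members (inside ∷ I) {suc t} (s≤s t≤) with members I t≤
... | f , inj , f∈ = g , g-inj , λ { zero → Vec.here ; (suc k) → Vec.there (f∈ k) }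
  where
  g : Fin (suc t) → Fin _
  g zero    = zero
  g (suc k) = suc (f k)
  g-inj : Injective _≡_ _≡_ g
  g-inj {zero}  {zero}  _ = refl
  g-inj {suc k} {suc l} e = cong suc (inj (Finₚ.suc-injective e))

module _ {n : ℕ} (ω : Fin (n * n) → Bool) where

  graphAdj : Fin n → Fin n → Bool
  graphAdj u v with u Fin.≟ v
  ... | yes _ = false
  ... | no _  = ω (code u v)

  graphAdj-≢ : ∀ {u v} → u ≢ v → graphAdj u v ≡ ω (code u v)
  graphAdj-≢ {u} {v} u≢v with u Fin.≟ v
  ... | yes u≡v = contradiction u≡v u≢v
  ... | no _    = refl

  graphAdj⇒ : ∀ u v → graphAdj u v ≡ true → ω (code u v) ≡ true
  graphAdj⇒ u v e with u Fin.≟ v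
  ... | no _ = e

  graph : Graph n
  graph .adj = graphAdj
  graph .irrefl v with v Fin.≟ v
  ... | yes _  = refl
  ... | no v≢v = contradiction refl v≢v
  graph .Graph.sym u v = by-cases (u Fin.≟ v)
    where
    by-cases : Dec (u ≡ v) → graphAdj u v ≡ graphAdj v u
    by-cases (yes refl) = refl
    by-cases (no u≢v)   = trans (graphAdj-≢ u≢v) (trans (cong ω (code-sym u v)) (sym (graphAdj-≢ (u≢v ∘ sym))))

-- The copy need not be induced: L lists only the links that must be present.
Contains : ∀ {n v} → Graph n → Links v → Set
Contains {n} {v} G L = ∃ λ (f : Fin v → Fin n) → Injective _≡_ _≡_ f ×
  All (λ (i , j) → adj G (f i) (f j) ≡ true) L

lookup-injective : ∀ {n v} {f : Fin v → Fin n} → Injective _≡_ _≡_ f →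
                   Injective _≡_ _≡_ (Vec.lookup (Vec.tabulate f))
lookup-injective {f = f} inj {i} {j} e =
  inj (trans (sym (lookup∘tabulate f i)) (trans e (lookup∘tabulate f j)))

no-copies : ∀ {n v} (ω : Fin (n * n) → Bool) {L : Links v} → Unique L → Ordered L →
            (∀ {H} → H ∈ distinctCopies {n} L → ¬ AllOn ω H) → ¬ Contains (graph {n} ω) L
no-copies {n} ω unique ordered avoids (f , inj , edges) =
  avoids (distinctCopies⁺ {n} (Vec.tabulate f) unique ordered (lookup-injective inj))
    (Allₚ.map⁺ (All.map (λ { {i , j} e →
      subst₂ (λ u v → ω (code u v) ≡ true) (sym (lookup∘tabulate f i)) (sym (lookup∘tabulate f j))
        (graphAdj⇒ {n} ω (f i) (f j) e) }) edges))

clique-free : ∀ {n s} (G : Graph n) → ¬ Contains G (pairs s) → KFree s G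
clique-free {s = s} G none f inj edges = none (f , inj ,
  All.map (λ { {i , j} i<j → edges i j λ { refl → <-irrefl refl i<j } }) (pairs-ordered s))

-- Shattered sets and crowns

module _ {n : ℕ} (G : Graph n) where

  trace-∈ : ∀ {S B v u} → N G v ∩ S ≡ B → u ∈ˢ B → adj G v u ≡ true
  trace-∈ {S} {v = v} {u} refl u∈B =
    trans (sym (lookup∘tabulate (adj G v) u)) ([]=⇒lookup (proj₁ (x∈p∩q⁻ (N G v) S u∈B)))

  trace-∉ : ∀ {S B v u} → N G v ∩ S ≡ B → u ∈ˢ S → u ∉ˢ B → adj G v u ≡ false
  trace-∉ {v = v} {u} refl u∈S u∉B = ¬-not λ e →
    u∉B (x∈p∩q⁺ (lookup⇒[]= u (N G v) (trans (lookup∘tabulate (adj G v) u) e) , u∈S))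

  Opposite : Subset n → Fin n → Fin n → Set
  Opposite S x y = ∃ λ w → w ≢ x × adj G w x ≡ false ×
    (∀ {u} → u ∈ˢ S → u ≢ x → u ≢ y → adj G w u ≡ true)

  -- The two subsets S − x and S − x − y have different witnesses, so one of
  -- them is not x itself.
  opposite : ∀ {S} → Shattered G S → ∀ x {y} → x ∈ˢ S → y ∈ˢ S → x ≢ y → Opposite S x y
  opposite {S} shattered x {y} x∈S y∈S x≢y = choose
    where
    B₁ = S ∩ ∁ ⁅ x ⁆
    B₂ = B₁ ∩ ∁ ⁅ y ⁆
    w₁ = shattered B₁ (p∩q⊆p S (∁ ⁅ x ⁆))
    w₂ = shattered B₂ (⊆-trans (p∩q⊆p B₁ (∁ ⁅ y ⁆)) (p∩q⊆p S (∁ ⁅ x ⁆)))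

    ∈B₁ : ∀ {u} → u ∈ˢ S → u ≢ x → u ∈ˢ B₁
    ∈B₁ u∈S u≢x = x∈p∩q⁺ (u∈S , x∉p⇒x∈∁p (u≢x ∘ x∈⁅y⁆⇒x≡y x))
    ∈B₂ : ∀ {u} → u ∈ˢ S → u ≢ x → u ≢ y → u ∈ˢ B₂
    ∈B₂ u∈S u≢x u≢y = x∈p∩q⁺ (∈B₁ u∈S u≢x , x∉p⇒x∈∁p (u≢y ∘ x∈⁅y⁆⇒x≡y y))
    x∉B₁ : x ∉ˢ B₁
    x∉B₁ x∈ = x∈∁p⇒x∉p (proj₂ (x∈p∩q⁻ S (∁ ⁅ x ⁆) x∈)) (x∈⁅x⁆ x)
    y∉B₂ : y ∉ˢ B₂
    y∉B₂ y∈ = x∈∁p⇒x∉p (proj₂ (x∈p∩q⁻ B₁ (∁ ⁅ y ⁆) y∈)) (x∈⁅x⁆ y)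

    w₁≢w₂ : proj₁ w₁ ≢ proj₁ w₂
    w₁≢w₂ e = contradiction
      (trans (sym (trace-∈ (proj₂ w₁) (∈B₁ y∈S (x≢y ∘ sym))))
             (trans (cong (λ w → adj G w y) e) (trace-∉ (proj₂ w₂) y∈S y∉B₂))) λ ()

    choose : Opposite S x y
    choose with proj₁ w₁ Fin.≟ x
    ... | no w₁≢x  = proj₁ w₁ , w₁≢x , trace-∉ (proj₂ w₁) x∈S x∉B₁ ,
                     λ u∈S u≢x _ → trace-∈ (proj₂ w₁) (∈B₁ u∈S u≢x)
    ... | yes w₁≡x = proj₁ w₂ , (λ w₂≡x → w₁≢w₂ (trans w₁≡x (sym w₂≡x))) ,
                     trace-∉ (proj₂ w₂) x∈S (x∉B₁ ∘ p∩q⊆p B₁ (∁ ⁅ y ⁆)) ,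
                     λ u∈S u≢x u≢y → trace-∈ (proj₂ w₂) (∈B₂ u∈S u≢x u≢y)

  -- The vertex `f zero` is given up as y; the other chosen vertices `x i` form one class and their
  -- opposites `w i` the second. For i ≠ j, `w j` is adjacent to `x i` while `w i` is not, so the
  -- opposites are distinct.
  crown-in-shattered : ∀ {S} k → Shattered G S → 2 + k ≤ ∣ S ∣ → Contains G (crown k)
  crown-in-shattered {S} k shattered large with members S large
  ... | f , f-inj , f∈S = g ∘ splitAt (suc k) , g-inj , All.tabulate edges
    where
    x : Fin (suc k) → Fin n
    x = f ∘ suc
    x-inj : Injective _≡_ _≡_ x
    x-inj = Finₚ.suc-injective ∘ f-inj
    opp : ∀ i → Opposite S (x i) (f zero)
    opp i = opposite shattered (x i) (f∈S (suc i)) (f∈S zero) (λ e → contradiction (f-inj e) λ ())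
    w : Fin (suc k) → Fin n
    w = proj₁ ∘ opp
    w~x : ∀ {i j} → i ≢ j → adj G (w i) (x j) ≡ true
    w~x {i} {j} i≢j = proj₂ (proj₂ (proj₂ (opp i))) (f∈S (suc j)) (i≢j ∘ sym ∘ x-inj)
                        (λ e → contradiction (f-inj e) λ ())
    w-inj : Injective _≡_ _≡_ w
    w-inj {i} {j} e with i Fin.≟ j
    ... | yes i≡j = i≡j
    ... | no i≢j  = contradiction
      (trans (sym (w~x (i≢j ∘ sym))) (trans (cong (λ z → adj G z (x i)) (sym e)) (proj₁ (proj₂ (proj₂ (opp i))))))
      λ ()
    -- Off the matching, `w j` is adjacent to `x i` and so differs from it; on the matching they
    -- differ by the choice made in `opposite`.
    x≢w : ∀ i j → x i ≢ w j
    x≢w i j e with j Fin.≟ i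
    ... | yes refl = proj₁ (proj₂ (opp j)) (sym e)
    ... | no j≢i   = contradiction
      (trans (sym (w~x j≢i)) (trans (cong (adj G (w j)) e) (irrefl G (w j)))) λ ()

    g : Fin (suc k) ⊎ Fin (suc k) → Fin n
    g = [ x , w ]
    g-inj : Injective _≡_ _≡_ (g ∘ splitAt (suc k))
    g-inj {p} {q} e with splitAt (suc k) p in ep | splitAt (suc k) q in eq
    ... | inj₁ i | inj₁ j with refl ← x-inj e =
      trans (sym (Finₚ.splitAt⁻¹-↑ˡ ep)) (Finₚ.splitAt⁻¹-↑ˡ eq)
    ... | inj₁ i | inj₂ j = contradiction e (x≢w i j)
    ... | inj₂ i | inj₁ j = contradiction (sym e) (x≢w j i)
    ... | inj₂ i | inj₂ j with refl ← w-inj e =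
      trans (sym (Finₚ.splitAt⁻¹-↑ʳ ep)) (Finₚ.splitAt⁻¹-↑ʳ eq)

    edges : ∀ {l} → l ∈ crown k →
            adj G (g (splitAt (suc k) (proj₁ l))) (g (splitAt (suc k) (proj₂ l))) ≡ true
    edges l∈ with crown-∈⁻ k l∈
    ... | i , j , refl
      rewrite Finₚ.splitAt-↑ˡ (suc k) i (suc k) | Finₚ.splitAt-↑ʳ (suc k) (suc k) (punchIn i j) =
      trans (Graph.sym G (x i) (w (punchIn i j))) (w~x (Finₚ.punchInᵢ≢i i j))

  small-shattered : ∀ {k d} → suc k ≤ d → ¬ Contains G (crown k) → VCdim≤ G d
  small-shattered k<d none S shattered = ≮⇒≥ λ d<S →
    none (crown-in-shattered _ shattered (≤-trans (s≤s k<d) d<S))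

meets-large : ∀ {n t} (ω : Fin (n * n) → Bool) →
  (∀ {P} → P ∈ distinctCopies {n} (pairs t) → ∃ λ i → i ∈ P × ω i ≡ true) →
  ∀ I → Independent (graph {n} ω) I → ∣ I ∣ < t
meets-large {n} {t} ω meets I independent = ≰⇒> λ t≤I → hit (members I t≤I)
  where
  hit : ¬ ∃ λ (f : Fin t → Fin n) → Injective _≡_ _≡_ f × (∀ k → f k ∈ˢ I)
  hit (f , inj , f∈I)
    with meets (distinctCopies⁺ {n} (Vec.tabulate f) (pairs-unique t) (pairs-ordered t) (lookup-injective inj))
  ... | c , c∈ , ωc with ∈-map⁻ _ c∈
  ...   | (i , j) , ij∈ , refl
    rewrite lookup∘tabulate f i | lookup∘tabulate f j =
    contradiction (trans (sym ωc) (trans (sym (graphAdj-≢ {n} ω fi≢fj)) (independent _ _ (f∈I i) (f∈I j)))) λ ()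
    where
    fi≢fj : f i ≢ f j
    fi≢fj e = <-irrefl (cong Fin.toℕ (inj e)) (All.lookup (pairs-ordered t) ij∈)

-- The 16 is the 8 of `half-sparse` times the 2 orientations in `placements`. It goes into K
-- together with the number of links, and `1 ≤ e` gives `K ≤ K ^ e`.
few-copies : ∀ {n v x K q e} .{{_ : NonZero n}} {L : Links (2 + v)} → Ordered L →
  length L ≡ suc e → 1 ≤ e → 1 ≤ x → n ^ 2 ≤ x ^ q → q * v ≤ e * 2 → 16 * suc e ≤ K →
  ∀ f → 8 * length (copiesThrough {n} L f) ≤ (K * x) ^ e
few-copies {n} {v} {x} {K} {q} {e} {L} ordered len 1≤e 1≤x n²≤ qv≤ K≥ f = begin
  8 * length (copiesThrough {n} L f)  ≡⟨ cong (8 *_) (number-copiesThrough ordered f) ⟩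
  8 * (length L * (2 * n ^ v))    ≡⟨ cong (λ z → 8 * (z * (2 * n ^ v))) len ⟩
  8 * (suc e * (2 * n ^ v))       ≡⟨ shuffle (suc e) (n ^ v) ⟩
  16 * suc e * n ^ v              ≤⟨ *-mono-≤ K≥ (power-transfer {n} {x} {q} {v} {e} {{>-nonZero 1≤x}} n²≤ qv≤) ⟩
  K * x ^ e                       ≤⟨ *-monoˡ-≤ (x ^ e) K≤Kᵉ ⟩
  K ^ e * x ^ e                   ≡⟨ ^-distribʳ-* e K x ⟨
  (K * x) ^ e                     ∎
  where
  open ≤-Reasoning
  shuffle : ∀ p q → 8 * (p * (2 * q)) ≡ 16 * p * q
  shuffle = solve-∀
  K≤Kᵉ : K ≤ K ^ e
  K≤Kᵉ = begin
    K     ≡⟨ *-identityʳ K ⟨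
    K ^ 1 ≤⟨ ^-monoʳ-≤ K {{>-nonZero (≤-trans (s≤s z≤n) K≥)}} 1≤e ⟩
    K ^ e ∎

-- Choice of parameters and assembly

module Construction {d s₀ K n x t : ℕ} (s+2≤d : 5 + s₀ ≤ d) (K≥ : 16 * (d * d) ≤ K)
  (1≤n : 1 ≤ n) (1≤K : 1 ≤ K) (1≤x : 1 ≤ x) (n²≤x^q : n ^ 2 ≤ x ^ (4 + s₀))
  (few : n ^ t * (1 + 2 * (K * x)) ^ length (pairs t) < (2 + 2 * (K * x)) ^ length (pairs t))
  where
  s q k : ℕ
  s = 3 + s₀
  q = 1 + s
  -- Crown classes then have s + 2 vertices, so that without crowns a shattered set has at most s +
  -- 2 elements.
  k = 1 + s

  instance
    n≢0 : NonZero n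
    n≢0 = >-nonZero 1≤n
    Kx≢0 : NonZero (K * x)
    Kx≢0 = >-nonZero (*-mono-≤ 1≤K 1≤x)

  e₁ e₂ : ℕ
  e₁ = pred (length (pairs s))
  -- Chosen so that `suc e₂` unfolds to `suc k * k`, the number of links of the crown.
  e₂ = 3 + s₀ + k * k

  length-clique : length (pairs s) ≡ suc e₁
  length-clique = sym (suc-pred (length (pairs s))
    {{>-nonZero (≤-trans (s≤s z≤n) (≤-reflexive (sym (length-pairs (2 + s₀)))))}})

  -- The clique meets the density condition with equality, s(s - 1) - 2 = (s + 1)(s - 2); this fixes
  -- the exponent 2/(s + 1).
  e₁*2 : e₁ * 2 ≡ q * (1 + s₀)
  e₁*2 = +-cancelʳ-≡ 2 _ _ (trans (shuffle₁ e₁)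
    (trans (cong (2 *_) (sym length-clique)) (trans (double-length-pairs (2 + s₀)) (shuffle₂ s₀))))
    where
    shuffle₁ : ∀ p → p * 2 + 2 ≡ 2 * suc p
    shuffle₁ = solve-∀
    shuffle₂ : ∀ p → (3 + p) * (2 + p) ≡ (4 + p) * (1 + p) + 2
    shuffle₂ = solve-∀

  1≤e₁ : 1 ≤ e₁
  1≤e₁ = *-cancelʳ-< 2 0 e₁ (≤-trans (s≤s z≤n) (≤-reflexive (sym e₁*2)))

  -- The crown has 2s + 4 vertices and (s + 2)(s + 1) links, which leaves a slack of 2s.
  e₂*2 : q * (3 + s₀ + suc k) ≤ e₂ * 2
  e₂*2 = ≤-trans (m≤m+n _ (2 * (3 + s₀))) (≤-reflexive (shuffle s₀))
    where
    shuffle : ∀ p → (4 + p) * (3 + p + (5 + p)) + 2 * (3 + p) ≡ (3 + p + (4 + p) * (4 + p)) * 2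
    shuffle = solve-∀

  K≥e₂ : 16 * suc e₂ ≤ K
  K≥e₂ = ≤-trans (*-monoʳ-≤ 16 (*-mono-≤ s+2≤d (≤-trans (n≤1+n k) s+2≤d))) K≥

  K≥e₁ : 16 * suc e₁ ≤ K
  K≥e₁ = ≤-trans (*-monoʳ-≤ 16 (begin
    suc e₁                 ≡⟨ length-clique ⟨
    length (pairs s)       ≤⟨ m≤m+n _ _ ⟩
    2 * length (pairs s)   ≡⟨ double-length-pairs (2 + s₀) ⟩
    s * (2 + s₀)           ≤⟨ *-mono-≤ (≤-trans (m≤n+m s 2) s+2≤d) (≤-trans (m≤n+m (2 + s₀) 3) s+2≤d) ⟩
    d * d                  ∎)) K≥
    where open ≤-Reasoning

  cliques crowns forbidden : List (List (Fin (n * n)))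
  cliques   = distinctCopies {n} (pairs s)
  crowns    = distinctCopies {n} (crown k)
  forbidden = cliques ++ crowns

  through : Fin (n * n) → List (List (Fin (n * n)))
  through f = copiesThrough {n} (pairs s) f ++ copiesThrough {n} (crown k) f

  forbidden⊆through : ∀ {H f} → H ∈ forbidden → f ∈ H → H ∈ through f
  forbidden⊆through {f = f} H∈ f∈H with ∈-++⁻ cliques H∈
  ... | inj₁ H∈₁ = ∈-++⁺ˡ (∈-copiesThrough {n} (pairs s) H∈₁ f∈H)
  ... | inj₂ H∈₂ = ∈-++⁺ʳ (copiesThrough {n} (pairs s) f) (∈-copiesThrough {n} (crown k) H∈₂ f∈H)

  forbidden-nonempty : ∀ {H} → H ∈ forbidden → 0 < length H
  forbidden-nonempty H∈ with ∈-++⁻ cliques H∈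
  ... | inj₁ H∈₁ = subst (0 <_)
    (sym (trans (length-distinctCopies {n} (pairs s) H∈₁) length-clique)) (s≤s z≤n)
  ... | inj₂ H∈₂ = subst (0 <_)
    (sym (trans (length-distinctCopies {n} (crown k) H∈₂) (length-crown k))) (s≤s z≤n)

  forbidden-unique : ∀ {H} → H ∈ forbidden → Unique H
  forbidden-unique H∈ with ∈-++⁻ cliques H∈
  ... | inj₁ H∈₁ = distinctCopies-unique {n} (pairs s) H∈₁
  ... | inj₂ H∈₂ = distinctCopies-unique {n} (crown k) H∈₂

  through-sparse : ∀ f → Weighted.Sparse (2 * (K * x)) (through f)
  through-sparse f = sparse-++ (K * x) e₁ e₂ (copiesThrough {n} (pairs s) f) (copiesThrough {n} (crown k) f)
    (λ H∈ → trans (length-copiesThrough {n} (pairs s) f H∈) length-clique)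
    (few-copies {n} {1 + s₀} {x} {K} {q} {e₁} (pairs-ordered s) length-clique 1≤e₁ 1≤x n²≤x^q
      (≤-reflexive (sym e₁*2)) K≥e₁ f)
    (λ H∈ → trans (length-copiesThrough {n} (crown k) f H∈) (length-crown k))
    (few-copies {n} {3 + s₀ + suc k} {x} {K} {q} {e₂} (crown-ordered k) (length-crown k) (s≤s z≤n) 1≤x n²≤x^q
      e₂*2 K≥e₂ f)

  few-candidates : length (distinctCopies {n} (pairs t)) * (1 + 2 * (K * x)) ^ length (pairs t)
                   < (2 + 2 * (K * x)) ^ length (pairs t)
  few-candidates = ≤-<-trans
    (*-monoˡ-≤ ((1 + 2 * (K * x)) ^ length (pairs t)) (number-distinctCopies {n} (pairs t))) few

  construction : ∃ λ (G : Graph n) → KFree s G × VCdim≤ G d × (∀ I → Independent G I → ∣ I ∣ < t)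
  construction = assemble (Alteration.alteration (2 * (K * x)) forbidden through forbidden⊆through
    forbidden-nonempty forbidden-unique through-sparse (distinctCopies {n} (pairs t)) (length (pairs t))
    (distinctCopies-unique {n} (pairs t)) (length-distinctCopies {n} (pairs t)) few-candidates)
    where
    assemble : (∃ λ (ω : Fin (n * n) → Bool) → (∀ {H} → H ∈ forbidden → ¬ AllOn ω H) ×
                 (∀ {P} → P ∈ distinctCopies {n} (pairs t) → ∃ λ i → i ∈ P × ω i ≡ true)) →
               ∃ λ (G : Graph n) → KFree s G × VCdim≤ G d × (∀ I → Independent G I → ∣ I ∣ < t)
    assemble (ω , avoids , meets) = graph {n} ω ,
      clique-free (graph {n} ω) (no-copies {n} ω (pairs-unique s) (pairs-ordered s) (avoids ∘ ∈-++⁺ˡ)) ,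
      small-shattered (graph {n} ω) {k} s+2≤d
        (no-copies {n} ω (crown-unique k) (crown-ordered k) (avoids ∘ ∈-++⁺ʳ cliques)) ,
      meets-large {n} ω meets

-- Since m < t, the summand 1 in the bound on t disappears. Raising the exponent of `24 * K` from s
-- + 1 to d makes the constant independent of s, and `suc` makes the inequality strict; `2 ≤ n`
-- keeps the logarithm positive.
final-count : ∀ {m n x t K d s} → m < t → t ≤ 1 + 2 * ((1 + 2 * (K * x)) * (1 + ⌊log₂ n ⌋)) →
  1 ≤ K → 1 ≤ x → x ^ (1 + s) ≤ 2 ^ (1 + s) * n ^ 2 → 1 + s ≤ d → 2 ≤ n →
  m ^ (s + 1) < suc ((24 * K) ^ d) * (n ^ 2) * (⌊log₂ n ⌋ ^ (s + 1))
final-count {m} {n} {x} {t} {K} {d} {s} m<t t≤ 1≤K 1≤x x^q≤ q≤d 2≤n rewrite +-comm s 1 = begin-strict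
  m ^ q                        ≤⟨ size-bound {x = x} {K} {q} 1≤K 1≤x 1≤ℓ (≤-pred (<-≤-trans m<t t≤)) x^q≤ ⟩
  (24 * K) ^ q * n ^ 2 * ℓ ^ q ≤⟨ *-monoˡ-≤ (ℓ ^ q) (*-monoˡ-≤ (n ^ 2) (^-monoʳ-≤ (24 * K) q≤d)) ⟩
  (24 * K) ^ d * n ^ 2 * ℓ ^ q <⟨ *-monoˡ-< (ℓ ^ q) (*-monoˡ-< (n ^ 2) (n<1+n ((24 * K) ^ d))) ⟩
  suc ((24 * K) ^ d) * n ^ 2 * ℓ ^ q ∎
  where
  open ≤-Reasoning
  q = 1 + s
  ℓ = ⌊log₂ n ⌋
  1≤ℓ : 1 ≤ ℓ
  1≤ℓ = ⌊log₂⌋-mono-≤ 2≤n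
  instance
    24K≢0 : NonZero (24 * K)
    24K≢0 = >-nonZero (≤-trans 1≤K (m≤m+n K (23 * K)))
    n²≢0 : NonZero (n ^ 2)
    n²≢0 = m^n≢0 n 2 {{>-nonZero (≤-trans (s≤s z≤n) 2≤n)}}
    ℓ^q≢0 : NonZero (ℓ ^ q)
    ℓ^q≢0 = m^n≢0 ℓ q {{>-nonZero 1≤ℓ}}

theorem2 : (d : ℕ) → 5 ≤ d →
    ∃ λ (C : ℕ) → (s : ℕ) → 3 ≤ s → s + 2 ≤ d → (n : ℕ) → 2 ≤ n →
    ∃ λ (G : Graph n) → KFree s G × VCdim≤ G d ×
    ((I : Subset n) → Independent G I →
    ∣ I ∣ ^ (s + 1) < C * (n ^ 2) * (⌊log₂ n ⌋ ^ (s + 1)))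
-- The bound on independent sets is raised to the power s + 1 to have integral exponents. The
-- constant depends on d alone, and passing from base 2 to natural logarithms changes only the
-- constant.
theorem2 d 5≤d = suc ((24 * K₀) ^ d) , λ s 3≤s s+2≤d n 2≤n →
  main K₀ ≤-refl 1≤K₀ s 3≤s (subst (_≤ d) (+-comm s 2) s+2≤d) n 2≤n
  where
  K₀ = 16 * (d * d)
  1≤d : 1 ≤ d
  1≤d = ≤-trans (s≤s z≤n) 5≤d
  1≤K₀ : 1 ≤ K₀
  1≤K₀ = ≤-trans (*-mono-≤ 1≤d 1≤d) (m≤m+n (d * d) (15 * (d * d)))

  main : ∀ K → 16 * (d * d) ≤ K → 1 ≤ K → (s : ℕ) → 3 ≤ s → 2 + s ≤ d → (n : ℕ) → 2 ≤ n →
    ∃ λ (G : Graph n) → KFree s G × VCdim≤ G d ×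
    ((I : Subset n) → Independent G I →
    ∣ I ∣ ^ (s + 1) < suc ((24 * K) ^ d) * (n ^ 2) * (⌊log₂ n ⌋ ^ (s + 1)))
  main K K≥ 1≤K s@(suc (suc (suc s₀))) (s≤s (s≤s (s≤s z≤n))) s+2≤d n 2≤n =
    let 1≤n = ≤-trans (s≤s z≤n) 2≤n
        x , 1≤x , n²≤ , x^q≤ = approximateRoot s (n ^ 2) (m^n>0 n {{>-nonZero 1≤n}} 2)
        -- The base is 1 + a for a = 2Kx, the value that fixes the edge probability 2 / (2 + a).
        t , t≤ , few = threshold n (1 + 2 * (K * x))
        G , Kₛ-free , vc , small = Construction.construction {t = t} s+2≤d K≥ 1≤n 1≤K 1≤x n²≤ few
    in G , Kₛ-free , vc , λ I independent →
       final-count {x = x} {t} {K} {d} {s} (small I independent) t≤ 1≤K 1≤x x^q≤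
         (≤-trans (n≤1+n (1 + s)) s+2≤d) 2≤n
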